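{- Let $(Q,C,D)$ be an instance of the bilinear assignment problem of sizes $m,n$ in which all entries of $Q$ are non-negative and $C$, $D$ are zero matrices. Then the objective value $f^*$ of any local optimum for the $2$-exchange neighborhood satisfies $$f^*\le\frac{2mn}{m+n}\,\mathcal{A}(Q,C,D).$$
   Context: Bilinear assignment problem (BAP): let $m\le n$ be positive integers, $M=\{1,\dots,m\}$, $N=\{1,\dots,n\}$. An instance $(Q,C,D)$ consists of a real $m\times m\times n\times n$ array $Q=(q_{ijkl})$, a real $m\times m$ matrix $C=(c_{ij})$ and a real $n\times n$ matrix $D=(d_{kl})$. Let $\mathcal{X}$ (resp. $\mathcal{Y}$) be the set of $m\times m$ (resp. $n\times n$) permutation matrices. The feasible set is $\mathcal{F}=\mathcal{X}\times\mathcal{Y}$, and the objective, to be minimized, is $$f(\mathbf{x},\mathbf{y})=\sum_{i,j\in M}\sum_{k,l\in N} q_{ijkl}x_{ij}y_{kl}+\sum_{i,j\in M}c_{ij}x_{ij}+\sum_{k,l\in N}d_{kl}y_{kl}.$$ $\mathcal{A}(Q,C,D)$ is the arithmetic mean of $f$ over $\mathcal{F}$. The $2$-exchange neighborhood of $(\mathbf{x},\mathbf{y})\in\mathcal{F}$ consists of all $(\mathbf{x}',\mathbf{y})$ where $\mathbf{x}'$ is obtained from $\mathbf{x}$ by swapping the assignments of two indices $i_1,i_2\in M$ (if $x_{i_1j_1}=x_{i_2j_2}=1$, then $x'_{i_1j_2}=x'_{i_2j_1}=1$, $x'_{i_1j_1}=x'_{i_2j_2}=0$, all else unchanged), together with all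 $(\mathbf{x},\mathbf{y}')$ where $\mathbf{y}'$ is obtained from $\mathbf{y}$ by swapping the assignments of two indices $k_1,k_2\in N$. A local optimum for a neighborhood is a feasible solution such that no solution in its neighborhood has strictly smaller objective value. -}

module Defs where

open import Algebra.Bundles using (RawMonoid)
import Algebra.Definitions.RawMonoid as Summation
open import Data.Bool.Base using (Bool; true; false; if_then_else_)
import Data.Bool.Properties as Bool
open import Data.Fin.Base using (Fin)
import Data.Fin.Properties as Fin
open import Data.Integer.Base using (+_)
open import Data.List.Base as List using (List; []; _∷_; length; filter; cartesianProduct; cartesianProductWith)
open import Data.Nat.Base as ℕ using (ℕ; zero; suc; NonZero)
import Data.Nat.Properties as ℕ
open import Data.Product using (∃!; ∃-syntax; _×_; _,_)
open import Data.Rational.Base as ℚ using (ℚ; 0ℚ; 1ℚ; ½; ∣_∣)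
import Data.Rational.Properties as ℚ
open import Data.Rational.Solver using (module +-*-Solver)
open import Data.Sum.Base using (_⊎_)
open import Data.Vec.Base as Vec using (Vec; []; _∷_; lookup)
open import Level using (0ℓ)
open import Relation.Binary.PropositionalEquality using (_≡_; _≢_; refl; sym; cong; subst)
open import Relation.Nullary.Decidable using (Dec; map′; _×-dec_; _→-dec_)
open import Relation.Nullary.Negation.Core using (¬_)

-- Real numbers: Cauchy sequences of rationals, with pointwise operations.
-- Equality of reals is _≈_, not _≡_.

IsCauchy : (ℕ → ℚ) → Set
IsCauchy s = ∀ ε → 0ℚ ℚ.< ε →
  ∃[ N ] (∀ {i j} → N ℕ.≤ i → N ℕ.≤ j → ∣ s i ℚ.- s j ∣ ℚ.< ε)

record ℝ : Set where
  field
    seq    : ℕ → ℚ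
    cauchy : IsCauchy seq
open ℝ public

infix 4 _≈_ _≤_ _<_

record _≈_ (x y : ℝ) : Set where
  constructor *≈*
  field eventually : ∀ ε → 0ℚ ℚ.< ε →
          ∃[ N ] (∀ {i} → N ℕ.≤ i → ∣ seq x i ℚ.- seq y i ∣ ℚ.< ε)

record _≤_ (x y : ℝ) : Set where
  constructor *≤*
  field eventually : ∀ ε → 0ℚ ℚ.< ε →
          ∃[ N ] (∀ {i} → N ℕ.≤ i → seq x i ℚ.≤ seq y i ℚ.+ ε)

record _<_ (x y : ℝ) : Set where
  constructor *<*
  field separated : ∃[ ε ] 0ℚ ℚ.< ε ×
          ∃[ N ] (∀ {i} → N ℕ.≤ i → seq x i ℚ.+ ε ℚ.≤ seq y i)

fromℚ : ℚ → ℝ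
fromℚ q = record
  { seq    = λ _ → q
  ; cauchy = λ _ 0<ε → 0 , λ _ _ → subst (ℚ._< _) (cong ∣_∣ (sym (ℚ.+-inverseʳ q))) 0<ε
  }

0ℝ 1ℝ : ℝ
0ℝ = fromℚ 0ℚ
1ℝ = fromℚ 1ℚ

private
  half-pos : ∀ {ε} → 0ℚ ℚ.< ε → 0ℚ ℚ.< ½ ℚ.* ε
  half-pos {ε} 0<ε = subst (ℚ._< ½ ℚ.* ε) (ℚ.*-zeroʳ ½) (ℚ.*-monoʳ-<-pos ½ 0<ε)

  half+half : ∀ ε → ½ ℚ.* ε ℚ.+ ½ ℚ.* ε ≡ ε
  half+half = solve 1 (λ e → con ½ :* e :+ con ½ :* e := e) refl
    where open +-*-Solver

  +-isCauchy : ∀ s t → IsCauchy s → IsCauchy t → IsCauchy (λ i → s i ℚ.+ t i)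
  +-isCauchy s t cs ct ε 0<ε with cs (½ ℚ.* ε) (half-pos 0<ε) | ct (½ ℚ.* ε) (half-pos 0<ε)
  ... | N₁ , p₁ | N₂ , p₂ = N₁ ℕ.⊔ N₂ , λ {i} {j} N≤i N≤j → begin-strict
    ∣ (s i ℚ.+ t i) ℚ.- (s j ℚ.+ t j) ∣
      ≡⟨ cong ∣_∣ (regroup (s i) (t i) (s j) (t j)) ⟩
    ∣ (s i ℚ.- s j) ℚ.+ (t i ℚ.- t j) ∣
      ≤⟨ ℚ.∣p+q∣≤∣p∣+∣q∣ (s i ℚ.- s j) (t i ℚ.- t j) ⟩
    ∣ s i ℚ.- s j ∣ ℚ.+ ∣ t i ℚ.- t j ∣
      <⟨ ℚ.+-mono-< (p₁ (ℕ.m⊔n≤o⇒m≤o N₁ N₂ N≤i) (ℕ.m⊔n≤o⇒m≤o N₁ N₂ N≤j))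
                    (p₂ (ℕ.m⊔n≤o⇒n≤o N₁ N₂ N≤i) (ℕ.m⊔n≤o⇒n≤o N₁ N₂ N≤j)) ⟩
    ½ ℚ.* ε ℚ.+ ½ ℚ.* ε
      ≡⟨ half+half ε ⟩
    ε ∎
    where
    open ℚ.≤-Reasoning
    regroup : ∀ a b c d → (a ℚ.+ b) ℚ.- (c ℚ.+ d) ≡ (a ℚ.- c) ℚ.+ (b ℚ.- d)
    regroup = solve 4 (λ a b c d → (a :+ b) :- (c :+ d) := (a :- c) :+ (b :- d)) refl
      where open +-*-Solver

  eventuallyBounded : ∀ s → IsCauchy s →
    ∃[ b ] 0ℚ ℚ.< b × ∃[ N ] (∀ {i} → N ℕ.≤ i → ∣ s i ∣ ℚ.< b)
  eventuallyBounded s cs with cs 1ℚ (ℚ.positive⁻¹ 1ℚ)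
  ... | N , p = ∣ s N ∣ ℚ.+ 1ℚ
              , ℚ.+-mono-≤-< (ℚ.0≤∣p∣ (s N)) (ℚ.positive⁻¹ 1ℚ)
              , N , λ {i} N≤i → begin-strict
    ∣ s i ∣                        ≡⟨ cong ∣_∣ (split (s N) (s i)) ⟩
    ∣ s N ℚ.+ (s i ℚ.- s N) ∣      ≤⟨ ℚ.∣p+q∣≤∣p∣+∣q∣ (s N) (s i ℚ.- s N) ⟩
    ∣ s N ∣ ℚ.+ ∣ s i ℚ.- s N ∣    <⟨ ℚ.+-monoʳ-< ∣ s N ∣ (p N≤i ℕ.≤-refl) ⟩
    ∣ s N ∣ ℚ.+ 1ℚ                 ∎
    where
    open ℚ.≤-Reasoning
    split : ∀ a b → b ≡ a ℚ.+ (b ℚ.- a)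
    split = solve 2 (λ a b → b := a :+ (b :- a)) refl
      where open +-*-Solver

  divide : ∀ {c ε} → 0ℚ ℚ.< c → 0ℚ ℚ.< ε → ∃[ δ ] 0ℚ ℚ.< δ × c ℚ.* δ ≡ ε
  divide {c} {ε} 0<c 0<ε = c⁻¹ ℚ.* ε , 0<c⁻¹ε , (begin-equality
    c ℚ.* (c⁻¹ ℚ.* ε)   ≡⟨ ℚ.*-assoc c c⁻¹ ε ⟨
    c ℚ.* c⁻¹ ℚ.* ε     ≡⟨ cong (ℚ._* ε) (ℚ.*-inverseʳ c {{c≢0}}) ⟩
    1ℚ ℚ.* ε            ≡⟨ ℚ.*-identityˡ ε ⟩
    ε                   ∎)
    where
    open ℚ.≤-Reasoning
    c≢0 : ℚ.NonZero c
    c≢0 = ℚ.pos⇒nonZero c {{ℚ.positive 0<c}}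
    c⁻¹ : ℚ
    c⁻¹ = ℚ.1/_ c {{c≢0}}
    0<c⁻¹ε : 0ℚ ℚ.< c⁻¹ ℚ.* ε
    0<c⁻¹ε = subst (ℚ._< c⁻¹ ℚ.* ε) (ℚ.*-zeroʳ c⁻¹)
      (ℚ.*-monoʳ-<-pos c⁻¹ {{ℚ.1/pos⇒pos c {{ℚ.positive 0<c}}}} 0<ε)

  *-isCauchy : ∀ s t → IsCauchy s → IsCauchy t → IsCauchy (λ i → s i ℚ.* t i)
  *-isCauchy s t cs ct ε 0<ε =
    let a , 0<a , K₁ , s<a = eventuallyBounded s cs
        b , 0<b , K₂ , t<b = eventuallyBounded t ct
        δ , 0<δ , cδ≡ε     = divide {a ℚ.+ b} (ℚ.+-mono-< 0<a 0<b) 0<ε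
    in main a b δ 0<δ cδ≡ε K₁ s<a K₂ t<b (cs δ 0<δ) (ct δ 0<δ)
    where
    regroup : ∀ x y z w → x ℚ.* y ℚ.- z ℚ.* w ≡ x ℚ.* (y ℚ.- w) ℚ.+ w ℚ.* (x ℚ.- z)
    regroup = solve 4 (λ x y z w → x :* y :- z :* w := x :* (y :- w) :+ w :* (x :- z)) refl
      where open +-*-Solver

    open ℚ.≤-Reasoning

    term : ∀ p q {c δ} → 0ℚ ℚ.< δ → ∣ p ∣ ℚ.< c → ∣ q ∣ ℚ.< δ → ∣ p ℚ.* q ∣ ℚ.< c ℚ.* δ
    term p q {c} {δ} 0<δ p<c q<δ = begin-strict
      ∣ p ℚ.* q ∣       ≡⟨ ℚ.∣p*q∣≡∣p∣*∣q∣ p q ⟩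
      ∣ p ∣ ℚ.* ∣ q ∣   ≤⟨ ℚ.*-monoˡ-≤-nonNeg ∣ p ∣ {{ℚ.nonNegative (ℚ.0≤∣p∣ p)}} (ℚ.<⇒≤ q<δ) ⟩
      ∣ p ∣ ℚ.* δ       <⟨ ℚ.*-monoˡ-<-pos δ {{ℚ.positive 0<δ}} p<c ⟩
      c ℚ.* δ           ∎

    main : ∀ a b δ → 0ℚ ℚ.< δ → (a ℚ.+ b) ℚ.* δ ≡ ε →
           ∀ K₁ → (∀ {i} → K₁ ℕ.≤ i → ∣ s i ∣ ℚ.< a) →
           ∀ K₂ → (∀ {i} → K₂ ℕ.≤ i → ∣ t i ∣ ℚ.< b) →
           ∃[ N ] (∀ {i j} → N ℕ.≤ i → N ℕ.≤ j → ∣ s i ℚ.- s j ∣ ℚ.< δ) →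
           ∃[ N ] (∀ {i j} → N ℕ.≤ i → N ℕ.≤ j → ∣ t i ℚ.- t j ∣ ℚ.< δ) →
           ∃[ N ] (∀ {i j} → N ℕ.≤ i → N ℕ.≤ j → ∣ s i ℚ.* t i ℚ.- s j ℚ.* t j ∣ ℚ.< ε)
    main a b δ 0<δ cδ≡ε K₁ s<a K₂ t<b (N₁ , p₁) (N₂ , p₂) = (K₁ ℕ.⊔ K₂) ℕ.⊔ (N₁ ℕ.⊔ N₂) , λ {i} {j} N≤i N≤j →
      let K≤i = ℕ.m⊔n≤o⇒m≤o (K₁ ℕ.⊔ K₂) (N₁ ℕ.⊔ N₂) N≤i
          K≤j = ℕ.m⊔n≤o⇒m≤o (K₁ ℕ.⊔ K₂) (N₁ ℕ.⊔ N₂) N≤j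
          L≤i = ℕ.m⊔n≤o⇒n≤o (K₁ ℕ.⊔ K₂) (N₁ ℕ.⊔ N₂) N≤i
          L≤j = ℕ.m⊔n≤o⇒n≤o (K₁ ℕ.⊔ K₂) (N₁ ℕ.⊔ N₂) N≤j
      in begin-strict
      ∣ s i ℚ.* t i ℚ.- s j ℚ.* t j ∣
        ≡⟨ cong ∣_∣ (regroup (s i) (t i) (s j) (t j)) ⟩
      ∣ s i ℚ.* (t i ℚ.- t j) ℚ.+ t j ℚ.* (s i ℚ.- s j) ∣
        ≤⟨ ℚ.∣p+q∣≤∣p∣+∣q∣ (s i ℚ.* (t i ℚ.- t j)) (t j ℚ.* (s i ℚ.- s j)) ⟩
      ∣ s i ℚ.* (t i ℚ.- t j) ∣ ℚ.+ ∣ t j ℚ.* (s i ℚ.- s j) ∣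
        <⟨ ℚ.+-mono-<
             (term (s i) (t i ℚ.- t j) 0<δ (s<a (ℕ.m⊔n≤o⇒m≤o K₁ K₂ K≤i))
               (p₂ (ℕ.m⊔n≤o⇒n≤o N₁ N₂ L≤i) (ℕ.m⊔n≤o⇒n≤o N₁ N₂ L≤j)))
             (term (t j) (s i ℚ.- s j) 0<δ (t<b (ℕ.m⊔n≤o⇒n≤o K₁ K₂ K≤j))
               (p₁ (ℕ.m⊔n≤o⇒m≤o N₁ N₂ L≤i) (ℕ.m⊔n≤o⇒m≤o N₁ N₂ L≤j))) ⟩
      a ℚ.* δ ℚ.+ b ℚ.* δ
        ≡⟨ ℚ.*-distribʳ-+ δ a b ⟨
      (a ℚ.+ b) ℚ.* δ
        ≡⟨ cδ≡ε ⟩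
      ε ∎

infixl 6 _+_
infixl 7 _*_

_+_ _*_ : ℝ → ℝ → ℝ
x + y = record { seq = λ i → seq x i ℚ.+ seq y i ; cauchy = +-isCauchy (seq x) (seq y) (cauchy x) (cauchy y) }
x * y = record { seq = λ i → seq x i ℚ.* seq y i ; cauchy = *-isCauchy (seq x) (seq y) (cauchy x) (cauchy y) }

+-rawMonoid : RawMonoid 0ℓ 0ℓ
+-rawMonoid = record { Carrier = ℝ ; _≈_ = _≈_ ; _∙_ = _+_ ; ε = 0ℝ }

∑ : ∀ {n} → (Fin n → ℝ) → ℝ
∑ = Summation.sum +-rawMonoid

-- The value at [] is a convention; it is only applied to nonempty lists below.
mean : List ℝ → ℝ
mean []          = 0ℝ
mean xs@(_ ∷ _) = fromℚ (+ 1 ℚ./ length xs) * List.foldr _+_ 0ℝ xs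

-- 0/1 matrices, with true for the entry 1 and false for the entry 0

BinMatrix : ℕ → Set
BinMatrix n = Vec (Vec Bool n) n

entry : ∀ {n} → BinMatrix n → Fin n → Fin n → Bool
entry x i j = lookup (lookup x i) j

⟦_⟧ : Bool → ℝ
⟦ b ⟧ = if b then 1ℝ else 0ℝ

IsPermutationMatrix : ∀ {n} → BinMatrix n → Set
IsPermutationMatrix x =
  (∀ i → ∃! _≡_ λ j → entry x i j ≡ true) ×
  (∀ j → ∃! _≡_ λ i → entry x i j ≡ true)

private
  ∃!? : ∀ {n} {P : Fin n → Set} → (∀ i → Dec (P i)) → Dec (∃! _≡_ P)
  ∃!? P? = map′ (λ (i , p , u) → i , p , λ {j} → u j) (λ (i , p , u) → i , p , λ j → u {j})
    (Fin.any? λ i → P? i ×-dec Fin.all? λ j → P? j →-dec (i Fin.≟ j))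

isPermutationMatrix? : ∀ {n} (x : BinMatrix n) → Dec (IsPermutationMatrix x)
isPermutationMatrix? x =
  (Fin.all? λ i → ∃!? λ j → entry x i j Bool.≟ true) ×-dec
  (Fin.all? λ j → ∃!? λ i → entry x i j Bool.≟ true)

allVecs : ∀ {A : Set} → List A → (n : ℕ) → List (Vec A n)
allVecs as zero    = [] ∷ []
allVecs as (suc n) = cartesianProductWith _∷_ as (allVecs as n)

permutationMatrices : (n : ℕ) → List (BinMatrix n)
permutationMatrices n =
  filter isPermutationMatrix? (allVecs (allVecs (true ∷ false ∷ []) n) n)

record Instance (m n : ℕ) : Set where
  field
    Q : Fin m → Fin m → Fin n → Fin n → ℝ
    C : Fin m → Fin m → ℝ
    D : Fin n → Fin n → ℝ

Solution : ℕ → ℕ → Set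
Solution m n = BinMatrix m × BinMatrix n

module _ {m n : ℕ} where

  Feasible : Solution m n → Set
  Feasible (x , y) = IsPermutationMatrix x × IsPermutationMatrix y

  objective : Instance m n → Solution m n → ℝ
  objective I (x , y) =
    (∑ λ i → ∑ λ j → ∑ λ k → ∑ λ l → Q i j k l * ⟦ entry x i j ⟧ * ⟦ entry y k l ⟧)
    + (∑ λ i → ∑ λ j → C i j * ⟦ entry x i j ⟧)
    + (∑ λ k → ∑ λ l → D k l * ⟦ entry y k l ⟧)
    where open Instance I

  feasibleSolutions : List (Solution m n)
  feasibleSolutions = cartesianProduct (permutationMatrices m) (permutationMatrices n)

  average : Instance m n → ℝ
  average I = mean (List.map (objective I) feasibleSolutions)

Swap : ∀ {n} → BinMatrix n → BinMatrix n → Set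
Swap x x′ = ∃[ i₁ ] ∃[ i₂ ] ∃[ j₁ ] ∃[ j₂ ]
    i₁ ≢ i₂
  × entry x i₁ j₁ ≡ true × entry x i₂ j₂ ≡ true
  × entry x′ i₁ j₂ ≡ true × entry x′ i₂ j₁ ≡ true
  × entry x′ i₁ j₁ ≡ false × entry x′ i₂ j₂ ≡ false
  × (∀ i j → ¬ ((i ≡ i₁ ⊎ i ≡ i₂) × (j ≡ j₁ ⊎ j ≡ j₂)) → entry x′ i j ≡ entry x i j)

Neighborhood : ℕ → ℕ → Set₁
Neighborhood m n = Solution m n → Solution m n → Set

2-exchange : ∀ {m n} → Neighborhood m n
2-exchange (x , y) (x′ , y′) = (Swap x x′ × y′ ≡ y) ⊎ (x′ ≡ x × Swap y y′)

IsLocalOptimum : ∀ {m n} → Neighborhood m n → Instance m n → Solution m n → Set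
IsLocalOptimum 𝒩 I s =
  Feasible s × (∀ s′ → 𝒩 s s′ → ¬ (objective I s′ < objective I s))

ratio : (m n : ℕ) .{{_ : NonZero m}} → ℚ
ratio m@(suc _) n = (+ (2 ℕ.* m ℕ.* n)) ℚ./ (m ℕ.+ n)

{-# OPTIONS --safe #-}

-- Let S be the sum of all q_ijkl, so that the mean of f is S / (mn). Averaging the optimality condition of x over all
-- pairs of rows, with y fixed, gives m f* ≤ Σ_ijk q_{i j k y(k)}; by non-negativity the right-hand side is at most S.
-- Symmetrically n f* ≤ S, hence (m + n) f* ≤ 2 S. The mean itself is computed by double counting: exchanging rows
-- permutes the permutation matrices, so each of the m² positions is occupied in a fraction 1 / m of them.
module Submission where

open import Defs hiding (_≈_; _≤_; _<_; _+_; _*_; +-rawMonoid; ∑; ⟦_⟧)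
open import Algebra.Bundles using (CommutativeSemiring)
import Algebra.Definitions.RawMonoid as RawMonoid
import Algebra.Properties.CommutativeMonoid.Mult
import Algebra.Properties.CommutativeMonoid.Sum
import Algebra.Properties.CommutativeSemigroup
import Algebra.Properties.Semiring.Mult
import Algebra.Properties.Semiring.Sum
open import Algebra.Structures using (IsCommutativeSemiring)
open import Algebra.Structures.Biased using (isCommutativeMonoidˡ; isCommutativeSemiringˡ)
open import Data.Bool.Base using (Bool; true; false; if_then_else_)
open import Data.Bool.Properties using (¬-not)
open import Data.Fin.Base using (Fin; zero; suc)
open import Data.Fin.Permutation using (Permutation′; _⟨$⟩ʳ_; _⟨$⟩ˡ_; flip; inverseˡ; inverseʳ; transpose)
import Data.Fin.Properties as Fin
open import Data.Integer.Base using (+_)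
import Data.Integer.Solver as ℤ
open import Data.List.Base as List using (List; []; _∷_; length; map; foldr; _++_; cartesianProduct; cartesianProductWith)
import Data.List.Properties as List
open import Data.List.Membership.Propositional using (_∈_)
open import Data.List.Membership.Propositional.Properties
  using (∈-map⁺; ∈-map⁻; ∈-filter⁺; ∈-filter⁻; ∈-cartesianProductWith⁺)
open import Data.List.Membership.Propositional.Properties.WithK using (unique∧set⇒bag)
open import Data.List.Relation.Binary.BagAndSetEquality using (∼bag⇒↭)
open import Data.List.Relation.Binary.Permutation.Propositional as ↭ using (_↭_)
open import Data.List.Relation.Unary.All using ([]; _∷_)
open import Data.List.Relation.Unary.AllPairs using ([]; _∷_)
open import Data.List.Relation.Unary.Any using (here; there)
open import Data.List.Relation.Unary.Unique.Propositional using (Unique)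
import Data.List.Relation.Unary.Unique.Propositional.Properties as Unique
open import Data.Nat.Base as ℕ using (ℕ; zero; suc; NonZero)
import Data.Nat.Properties as ℕ
open import Data.Product using (∃!; ∃-syntax; _×_; _,_; proj₂)
open import Data.Rational.Base as ℚ using (ℚ; 0ℚ; 1ℚ; ½; ∣_∣; toℚᵘ)
import Data.Rational.Properties as ℚ
open import Data.Rational.Solver using (module +-*-Solver)
open import Data.Rational.Unnormalised.Base as ℚᵘ using (mkℚᵘ; *≡*)
import Data.Rational.Unnormalised.Properties as ℚᵘ
open import Data.Sum.Base using (_⊎_; inj₁; inj₂)
open import Data.Vec.Base using (Vec; []; _∷_; lookup; tabulate)
open import Data.Vec.Properties using (∷-injective; lookup∘tabulate; tabulate∘lookup; tabulate-cong)
open import Function.Bundles using (mk⇔)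
open import Level using (0ℓ)
open import Relation.Binary.Bundles using (Preorder)
open import Relation.Binary.PropositionalEquality as ≡ using (_≡_; _≢_; cong; cong₂; subst; subst₂)
import Relation.Binary.Reasoning.Preorder
import Relation.Binary.Reasoning.Setoid
open import Relation.Binary.Structures using (IsEquivalence; IsPreorder)
open import Relation.Nullary.Decidable using (yes; no; does; dec-true; dec-false)
open import Relation.Nullary.Negation.Core using (¬_; contradiction)

-- Averaging works because a swap changes only two terms. With `y` fixed, `a` the resulting cost
-- matrix and σ the permutation of `x`, optimality against the swap of rows i₁, i₂ says a(i₁,σi₁) +
-- a(i₂,σi₂) ≤ a(i₁,σi₂) + a(i₂,σi₁). Over all ordered pairs the left sides add up to 2m times the
-- cost, and the right sides to twice the sum of all entries of `a`, since σ is a bijection. The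
-- reals shape the rest. Their equality `_≈_` holds only in the limit and their operations carry
-- Cauchy proofs, so the combinatorics lives in an abstract commutative semiring with a preorder;
-- `ℝ` becomes an instance under index-by-index equality, where the laws come straight from `ℚ`.
-- Such a semiring has neither subtraction nor division: differences are compared by adding the
-- missing terms to both sides, and fractions are cleared by natural multiples `n · x`, which are
-- cancelled at the end.

-- Row permutations and swaps of permutation matrices

permuteRows : ∀ {n} → Permutation′ n → BinMatrix n → BinMatrix n
permuteRows π x = tabulate λ i → lookup x (π ⟨$⟩ʳ i)

entry-permuteRows : ∀ {n} (π : Permutation′ n) x i j → entry (permuteRows π x) i j ≡ entry x (π ⟨$⟩ʳ i) j
entry-permuteRows π x i j = cong (λ r → lookup r j) (lookup∘tabulate (λ i → lookup x (π ⟨$⟩ʳ i)) i)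

permuteRows-flip : ∀ {n} (π : Permutation′ n) x → permuteRows π (permuteRows (flip π) x) ≡ x
permuteRows-flip π x = ≡.trans
  (tabulate-cong λ i → ≡.trans (lookup∘tabulate (λ i → lookup x (π ⟨$⟩ˡ i)) (π ⟨$⟩ʳ i))
                               (cong (lookup x) (inverseˡ π)))
  (tabulate∘lookup x)

permuteRows-isPermutationMatrix : ∀ {n} (π : Permutation′ n) x →
  IsPermutationMatrix x → IsPermutationMatrix (permuteRows π x)
permuteRows-isPermutationMatrix π x (rows , cols) = rows′ , cols′
  where
  rows′ : ∀ i → ∃! _≡_ λ j → entry (permuteRows π x) i j ≡ true
  rows′ i with j , xj , unique ← rows (π ⟨$⟩ʳ i) =
    j , ≡.trans (entry-permuteRows π x i j) xj ,
    λ {j′} x′j′ → unique (≡.trans (≡.sym (entry-permuteRows π x i j′)) x′j′)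
  cols′ : ∀ j → ∃! _≡_ λ i → entry (permuteRows π x) i j ≡ true
  cols′ j with i , xi , unique ← cols j =
    π ⟨$⟩ˡ i ,
    ≡.trans (entry-permuteRows π x (π ⟨$⟩ˡ i) j) (≡.trans (cong (λ i → entry x i j) (inverseʳ π)) xi) ,
    λ {i′} x′i′ → ≡.trans
      (cong (π ⟨$⟩ˡ_) (unique (≡.trans (≡.sym (entry-permuteRows π x i′ j)) x′i′)))
      (inverseˡ π)

transpose-first : ∀ {n} (i j : Fin n) → transpose i j ⟨$⟩ʳ i ≡ j
transpose-first i j rewrite dec-true (i Fin.≟ i) ≡.refl = ≡.refl

transpose-second : ∀ {n} (i j : Fin n) → transpose i j ⟨$⟩ʳ j ≡ i
transpose-second i j with j Fin.≟ i
... | yes j≡i = j≡i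
... | no  _ rewrite dec-true (j Fin.≟ j) ≡.refl = ≡.refl

transpose-other : ∀ {n} {i j k : Fin n} → k ≢ i → k ≢ j → transpose i j ⟨$⟩ʳ k ≡ k
transpose-other {i = i} {j} {k} k≢i k≢j
  rewrite dec-false (k Fin.≟ i) k≢i | dec-false (k Fin.≟ j) k≢j = ≡.refl

-- Connects the relation `Swap`, against which optimality is assumed, with an explicit matrix whose
-- cost can be computed. The old positions become `false` because two distinct rows of `x` cannot
-- share a column.
swap-transpose : ∀ {n} (x : BinMatrix n) → IsPermutationMatrix x → ∀ {i₁ i₂} → i₁ ≢ i₂ →
  Swap x (permuteRows (transpose i₁ i₂) x)
swap-transpose x (rows , cols) {i₁} {i₂} i₁≢i₂
  with j₁ , xj₁ , unique₁ ← rows i₁ | j₂ , xj₂ , unique₂ ← rows i₂ =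
  i₁ , i₂ , j₁ , j₂ , i₁≢i₂ , xj₁ , xj₂ ,
  ≡.trans (at-first j₂) xj₂ , ≡.trans (at-second j₁) xj₁ ,
  ≡.trans (at-first j₁) (off₂ (λ j₁≡j₂ → i₁≢i₂ (same-column xj₁ (≡.trans (cong (entry x i₂) j₁≡j₂) xj₂)))) ,
  ≡.trans (at-second j₂) (off₁ (λ j₂≡j₁ → i₁≢i₂ (same-column (≡.trans (cong (entry x i₁) j₂≡j₁) xj₁) xj₂))) ,
  elsewhere
  where
  x′ = permuteRows (transpose i₁ i₂) x

  same-column : ∀ {i i′ j} → entry x i j ≡ true → entry x i′ j ≡ true → i ≡ i′
  same-column {j = j} xi xi′ with _ , _ , unique ← cols j = ≡.trans (≡.sym (unique xi)) (unique xi′)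

  at-first : ∀ j → entry x′ i₁ j ≡ entry x i₂ j
  at-first j = ≡.trans (entry-permuteRows (transpose i₁ i₂) x i₁ j) (cong (λ i → entry x i j) (transpose-first i₁ i₂))

  at-second : ∀ j → entry x′ i₂ j ≡ entry x i₁ j
  at-second j = ≡.trans (entry-permuteRows (transpose i₁ i₂) x i₂ j) (cong (λ i → entry x i j) (transpose-second i₁ i₂))

  off₁ : ∀ {j} → j ≢ j₁ → entry x i₁ j ≡ false
  off₁ j≢j₁ = ¬-not λ xj → j≢j₁ (≡.sym (unique₁ xj))

  off₂ : ∀ {j} → j ≢ j₂ → entry x i₂ j ≡ false
  off₂ j≢j₂ = ¬-not λ xj → j≢j₂ (≡.sym (unique₂ xj))

  elsewhere : ∀ i j → ¬ ((i ≡ i₁ ⊎ i ≡ i₂) × (j ≡ j₁ ⊎ j ≡ j₂)) → entry x′ i j ≡ entry x i j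
  elsewhere i j outside with i Fin.≟ i₁ | i Fin.≟ i₂
  -- In an exchanged row, away from the columns `j₁` and `j₂`, the old and the new entry are both
  -- `false`.
  ... | yes ≡.refl | _ = ≡.trans (at-first j) (≡.trans
    (off₂ λ j≡j₂ → outside (inj₁ ≡.refl , inj₂ j≡j₂))
    (≡.sym (off₁ λ j≡j₁ → outside (inj₁ ≡.refl , inj₁ j≡j₁))))
  ... | no _ | yes ≡.refl = ≡.trans (at-second j) (≡.trans
    (off₁ λ j≡j₁ → outside (inj₂ ≡.refl , inj₁ j≡j₁))
    (≡.sym (off₂ λ j≡j₂ → outside (inj₂ ≡.refl , inj₂ j≡j₂))))
  ... | no i≢i₁ | no i≢i₂ = ≡.trans (entry-permuteRows (transpose i₁ i₂) x i j)
    (cong (λ i → entry x i j) (transpose-other i≢i₁ i≢i₂))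

-- The list of all permutation matrices

length-cartesianProductWith : ∀ {A B C : Set} (f : A → B → C) xs ys →
  length (cartesianProductWith f xs ys) ≡ length xs ℕ.* length ys
length-cartesianProductWith f []       ys = ≡.refl
length-cartesianProductWith f (x ∷ xs) ys = ≡.trans
  (List.length-++ (map (f x) ys))
  (cong₂ ℕ._+_ (List.length-map (f x) ys) (length-cartesianProductWith f xs ys))

allVecs-complete : ∀ {A : Set} {as : List A} → (∀ a → a ∈ as) → ∀ {n} (v : Vec A n) → v ∈ allVecs as n
allVecs-complete complete []      = here ≡.refl
allVecs-complete complete (a ∷ v) = ∈-cartesianProductWith⁺ _∷_ (complete a) (allVecs-complete complete v)

allVecs-unique : ∀ {A : Set} {as : List A} → Unique as → ∀ n → Unique (allVecs as n)
allVecs-unique as! zero    = [] ∷ []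
allVecs-unique as! (suc n) = Unique.cartesianProductWith⁺ _∷_ ∷-injective as! (allVecs-unique as! n)

permutationMatrices-unique : ∀ n → Unique (permutationMatrices n)
permutationMatrices-unique n =
  Unique.filter⁺ isPermutationMatrix? (allVecs-unique (allVecs-unique (((λ ()) ∷ []) ∷ [] ∷ []) n) n)

∈-permutationMatrices⁺ : ∀ {n} {x : BinMatrix n} → IsPermutationMatrix x → x ∈ permutationMatrices n
∈-permutationMatrices⁺ {x = x} = ∈-filter⁺ isPermutationMatrix? (allVecs-complete (allVecs-complete bools) x)
  where
  bools : ∀ b → b ∈ true ∷ false ∷ []
  bools true  = here ≡.refl
  bools false = there (here ≡.refl)

∈-permutationMatrices⁻ : ∀ {n} {x : BinMatrix n} → x ∈ permutationMatrices n → IsPermutationMatrix x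
∈-permutationMatrices⁻ {n} {x} x∈ =
  proj₂ (∈-filter⁻ isPermutationMatrix? {v = x} {xs = allVecs (allVecs (true ∷ false ∷ []) n) n} x∈)

-- Both lists are free of duplicates and have the same members, `flip π` providing the preimages;
-- for such lists, equality as sets is equality as bags. This allows sums over all permutation
-- matrices to be reindexed.
map-permuteRows-↭ : ∀ {n} (π : Permutation′ n) → map (permuteRows π) (permutationMatrices n) ↭ permutationMatrices n
map-permuteRows-↭ {n} π = ∼bag⇒↭ (unique∧set⇒bag
  (Unique.map⁺ injective (permutationMatrices-unique n)) (permutationMatrices-unique n) (mk⇔ to from))
  where
  injective : ∀ {x y} → permuteRows π x ≡ permuteRows π y → x ≡ y
  injective {x} {y} eq = ≡.trans (≡.sym (permuteRows-flip (flip π) x))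
    (≡.trans (cong (permuteRows (flip π)) eq) (permuteRows-flip (flip π) y))

  to : ∀ {x} → x ∈ map (permuteRows π) (permutationMatrices n) → x ∈ permutationMatrices n
  to x∈ with y , y∈ , ≡.refl ← ∈-map⁻ (permuteRows π) x∈ =
    ∈-permutationMatrices⁺ {x = permuteRows π y} (permuteRows-isPermutationMatrix π y (∈-permutationMatrices⁻ {x = y} y∈))

  from : ∀ {x} → x ∈ permutationMatrices n → x ∈ map (permuteRows π) (permutationMatrices n)
  from {x} x∈ = subst (_∈ map (permuteRows π) (permutationMatrices n)) (permuteRows-flip π x)
    (∈-map⁺ (permuteRows π) (∈-permutationMatrices⁺ {x = permuteRows (flip π) x}
      (permuteRows-isPermutationMatrix (flip π) x (∈-permutationMatrices⁻ {x = x} x∈))))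

-- Cancellation of summands stands in for subtraction, and cancellation of natural multiples for
-- division. Monotonicity of products is not among the laws: inequalities are only ever multiplied
-- by entries that are 0 or 1.
record PreorderedSemiring : Set₁ where
  field
    commutativeSemiring : CommutativeSemiring 0ℓ 0ℓ

  open CommutativeSemiring commutativeSemiring public
  open RawMonoid +-rawMonoid public using () renaming (_×_ to infixr 7 _·_; sum to ∑)

  infix 4 _≤_
  field
    _≤_          : Carrier → Carrier → Set
    isPreorder   : IsPreorder _≈_ _≤_
    +-mono-≤     : ∀ {x y u v} → x ≤ y → u ≤ v → x + u ≤ y + v
    +-cancelʳ-≤  : ∀ {x y} z → x + z ≤ y + z → x ≤ y
    ·-cancelˡ-≤  : ∀ n .{{_ : NonZero n}} {x y} → n · x ≤ n · y → x ≤ y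

module Assignment (R : PreorderedSemiring) where

  open PreorderedSemiring R hiding (zero)
  open Algebra.Properties.CommutativeMonoid.Mult +-commutativeMonoid using ()
    renaming (×-congʳ to ·-congʳ; ×-assocˡ to ·-assocˡ; ×-homo-+ to ·-homo-+; ×-distrib-+ to ·-distrib-+)
  open Algebra.Properties.CommutativeMonoid.Sum +-commutativeMonoid
    using (sum-cong-≋; sum-replicate; sum-replicate-zero; ∑-comm; ∑-distrib-+)
  open Algebra.Properties.CommutativeSemigroup +-commutativeSemigroup using (x∙yz≈y∙xz; x∙yz≈z∙yx)
  open Algebra.Properties.CommutativeSemigroup *-commutativeSemigroup using (xy∙z≈xz∙y)
  open Algebra.Properties.Semiring.Mult semiring using () renaming (×-comm-* to ·-comm-*)
  open Algebra.Properties.Semiring.Sum semiring using (*-distribˡ-sum; *-distribʳ-sum)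
  open IsPreorder isPreorder using () renaming (reflexive to ≤-reflexive; refl to ≤-refl; trans to ≤-trans)

  module ≈-Reasoning = Relation.Binary.Reasoning.Setoid setoid
  ≤-preorder : Preorder 0ℓ 0ℓ 0ℓ
  ≤-preorder = record { isPreorder = isPreorder }

  module ≤-Reasoning = Relation.Binary.Reasoning.Preorder ≤-preorder

  ⟦_⟧ : Bool → Carrier
  ⟦ b ⟧ = if b then 1# else 0#

  -- Finite sums and indicator functions

  ∑-cong : ∀ {n} {f g : Fin n → Carrier} → (∀ i → f i ≈ g i) → ∑ f ≈ ∑ g
  ∑-cong = sum-cong-≋

  ∑-mono-≤ : ∀ {n} {f g : Fin n → Carrier} → (∀ i → f i ≤ g i) → ∑ f ≤ ∑ g
  ∑-mono-≤ {zero}  f≤g = ≤-refl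
  ∑-mono-≤ {suc n} f≤g = +-mono-≤ (f≤g zero) (∑-mono-≤ λ i → f≤g (suc i))

  ∑-const : ∀ n x → ∑ {n} (λ _ → x) ≈ n · x
  ∑-const n x = sum-replicate n

  ∑-zero : ∀ n → ∑ {n} (λ _ → 0#) ≈ 0#
  ∑-zero = sum-replicate-zero

  ·-∑ : ∀ k {n} (f : Fin n → Carrier) → k · ∑ f ≈ (∑ λ i → k · f i)
  ·-∑ k {zero}  f = trans (sym (∑-const k 0#)) (∑-zero k)
  ·-∑ k {suc n} f = trans (·-distrib-+ (f zero) (∑ λ i → f (suc i)) k) (+-congˡ (·-∑ k λ i → f (suc i)))

  ·-mono-≤ : ∀ n {x y} → x ≤ y → n · x ≤ n · y
  ·-mono-≤ zero    x≤y = ≤-refl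
  ·-mono-≤ (suc n) x≤y = +-mono-≤ x≤y (·-mono-≤ n x≤y)

  ∑∑-comm : ∀ {m n} (f : Fin m → Fin m → Fin n → Fin n → Carrier) →
    (∑ λ i → ∑ λ j → ∑ λ k → ∑ λ l → f i j k l) ≈ (∑ λ k → ∑ λ l → ∑ λ i → ∑ λ j → f i j k l)
  ∑∑-comm f = begin
    (∑ λ i → ∑ λ j → ∑ λ k → ∑ λ l → f i j k l)  ≈⟨ ∑-cong (λ i → ∑-comm (λ j k → ∑ (f i j k))) ⟩
    (∑ λ i → ∑ λ k → ∑ λ j → ∑ λ l → f i j k l)  ≈⟨ ∑-comm (λ i k → ∑ λ j → ∑ (f i j k)) ⟩
    (∑ λ k → ∑ λ i → ∑ λ j → ∑ λ l → f i j k l)  ≈⟨ ∑-cong (λ k → ∑-cong λ i → ∑-comm (λ j l → f i j k l)) ⟩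
    (∑ λ k → ∑ λ i → ∑ λ l → ∑ λ j → f i j k l)  ≈⟨ ∑-cong (λ k → ∑-comm (λ i l → ∑ λ j → f i j k l)) ⟩
    (∑ λ k → ∑ λ l → ∑ λ i → ∑ λ j → f i j k l)  ∎
    where open ≈-Reasoning

  -- A Kronecker delta with weight `v`. Testing `does` makes it compute on `zero` and `suc`, so
  -- `∑-single` goes by induction on the index without deciding equalities.
  single : ∀ {n} → Fin n → Carrier → Fin n → Carrier
  single i₀ v i = if does (i Fin.≟ i₀) then v else 0#

  ∑-single : ∀ {n} (f : Fin n → Carrier) i₀ → (∑ λ i → single i₀ (f i) i) ≈ f i₀
  ∑-single {suc n} f zero     = trans (+-congˡ (∑-zero n)) (+-identityʳ (f zero))
  ∑-single         f (suc i₀) = trans (+-identityˡ _) (∑-single (λ i → f (suc i)) i₀)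

  ∑-⟦∃!⟧ : ∀ {n} {b : Fin n → Bool} → ∃! _≡_ (λ i → b i ≡ true) → (∑ λ i → ⟦ b i ⟧) ≈ 1#
  ∑-⟦∃!⟧ {b = b} (i₀ , bi₀ , unique) = trans (∑-cong indicator) (∑-single (λ _ → 1#) i₀)
    where
    indicator : ∀ i → ⟦ b i ⟧ ≈ single i₀ 1# i
    indicator i with i Fin.≟ i₀
    ... | yes ≡.refl = reflexive (cong ⟦_⟧ bi₀)
    ... | no i≢i₀ with b i in bi
    ...   | true  = contradiction (≡.sym (unique bi)) i≢i₀
    ...   | false = refl

  -- Swap-optimal solutions of the linear assignment problem

  cost : ∀ {n} → (Fin n → Fin n → Carrier) → BinMatrix n → Carrier
  cost a x = ∑ λ i → ∑ λ j → a i j * ⟦ entry x i j ⟧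

  module _ {n} {a : Fin n → Fin n → Carrier} (x : BinMatrix n) (x-perm : IsPermutationMatrix x) where

    private
      -- If σ is the permutation of `x`, this is a(i, σ(i′)): what row `i` would cost in the column
      -- now held by row `i′`. The diagonal sums to `cost a x` by definition.
      rowCost : Fin n → Fin n → Carrier
      rowCost i i′ = ∑ λ j → a i j * ⟦ entry x i′ j ⟧

      cost-permuteRows : ∀ π → cost a (permuteRows π x) ≈ ∑ λ i → rowCost i (π ⟨$⟩ʳ i)
      cost-permuteRows π = ∑-cong λ i → ∑-cong λ j → *-congˡ (reflexive (cong ⟦_⟧ (entry-permuteRows π x i j)))

      module _ {i₁ i₂ : Fin n} (i₁≢i₂ : i₁ ≢ i₂) where

        π : Permutation′ n
        π = transpose i₁ i₂

        -- A subtraction-free form of the change in row `i`: at `i₁` and `i₂` each side receives the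
        -- term that only the other side has, and elsewhere both corrections are zero.
        rowCost-transpose : ∀ i →
          rowCost i (π ⟨$⟩ʳ i) + ((single i₁ (rowCost i i) i) + (single i₂ (rowCost i i) i)) ≈
          rowCost i i + ((single i₁ (rowCost i i₂) i) + (single i₂ (rowCost i i₁) i))
        -- The tests that select the corrections also compute `transpose`, so one case split settles
        -- both.
        rowCost-transpose i with i Fin.≟ i₁
        ... | yes ≡.refl rewrite dec-false (i₁ Fin.≟ i₂) i₁≢i₂ = x∙yz≈y∙xz (rowCost i₁ i₂) (rowCost i₁ i₁) 0#
        ... | no _ with i Fin.≟ i₂
        ...   | yes ≡.refl = x∙yz≈z∙yx (rowCost i₂ i₁) 0# (rowCost i₂ i₂)
        ...   | no _       = refl

        ∑-single-two : ∀ (f g h : Fin n → Carrier) →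
          (∑ λ i → f i + ((single i₁ (g i) i) + (single i₂ (h i) i))) ≈ ∑ f + (g i₁ + h i₂)
        ∑-single-two f g h = begin
          (∑ λ i → f i + ((single i₁ (g i) i) + (single i₂ (h i) i)))
            ≈⟨ ∑-distrib-+ f (λ i → (single i₁ (g i) i) + (single i₂ (h i) i)) ⟩
          ∑ f + (∑ λ i → (single i₁ (g i) i) + (single i₂ (h i) i))
            ≈⟨ +-congˡ (∑-distrib-+ (λ i → single i₁ (g i) i) (λ i → single i₂ (h i) i)) ⟩
          ∑ f + ((∑ λ i → single i₁ (g i) i) + (∑ λ i → single i₂ (h i) i))
            ≈⟨ +-congˡ (+-cong (∑-single g i₁) (∑-single h i₂)) ⟩
          ∑ f + (g i₁ + h i₂)
            ∎
          where open ≈-Reasoning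

        cost-transpose :
          cost a (permuteRows π x) + (rowCost i₁ i₁ + rowCost i₂ i₂) ≈ cost a x + (rowCost i₁ i₂ + rowCost i₂ i₁)
        cost-transpose = begin
          cost a (permuteRows π x) + (rowCost i₁ i₁ + rowCost i₂ i₂)
            ≈⟨ +-congʳ (cost-permuteRows π) ⟩
          (∑ λ i → rowCost i (π ⟨$⟩ʳ i)) + (rowCost i₁ i₁ + rowCost i₂ i₂)
            ≈⟨ ∑-single-two (λ i → rowCost i (π ⟨$⟩ʳ i)) (λ i → rowCost i i) (λ i → rowCost i i) ⟨
          (∑ λ i → rowCost i (π ⟨$⟩ʳ i) + ((single i₁ (rowCost i i) i) + (single i₂ (rowCost i i) i)))
            ≈⟨ ∑-cong rowCost-transpose ⟩
          (∑ λ i → rowCost i i + ((single i₁ (rowCost i i₂) i) + (single i₂ (rowCost i i₁) i)))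
            ≈⟨ ∑-single-two (λ i → rowCost i i) (λ i → rowCost i i₂) (λ i → rowCost i i₁) ⟩
          cost a x + (rowCost i₁ i₂ + rowCost i₂ i₁)
            ∎
          where open ≈-Reasoning

      -- Exactly one row `i′` of `x` occupies column `j`, so for fixed `i` each `a i j` is counted
      -- once.
      ∑∑-rowCost : (∑ λ i → ∑ λ i′ → rowCost i i′) ≈ (∑ λ i → ∑ λ j → a i j)
      ∑∑-rowCost = ∑-cong λ i → begin
        (∑ λ i′ → ∑ λ j → a i j * ⟦ entry x i′ j ⟧)    ≈⟨ ∑-comm (λ i′ j → a i j * ⟦ entry x i′ j ⟧) ⟩
        (∑ λ j → ∑ λ i′ → a i j * ⟦ entry x i′ j ⟧)    ≈⟨ ∑-cong (λ j → *-distribˡ-sum (a i j) (λ i′ → ⟦ entry x i′ j ⟧)) ⟨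
        (∑ λ j → a i j * (∑ λ i′ → ⟦ entry x i′ j ⟧))  ≈⟨ ∑-cong (λ j → *-congˡ (∑-⟦∃!⟧ (proj₂ x-perm j))) ⟩
        (∑ λ j → a i j * 1#)                           ≈⟨ ∑-cong (λ j → *-identityʳ (a i j)) ⟩
        (∑ λ j → a i j)                                ∎
        where open ≈-Reasoning

    -- Ordered pairs of rows are used, diagonal included, so that both double sums run over full
    -- ranges; the price is a factor 2 on both sides, cancelled at once. The diagonal pairs are
    -- trivial inequalities.
    swap-optimal⇒cost≤ : (∀ x′ → Swap x x′ → cost a x ≤ cost a x′) → n · cost a x ≤ (∑ λ i → ∑ λ j → a i j)
    swap-optimal⇒cost≤ optimal = ·-cancelˡ-≤ 2 (begin
      2 · (n · cost a x)
        ≈⟨ +-congˡ (+-identityʳ _) ⟩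
      n · cost a x + n · cost a x
        ≈⟨ +-cong left right ⟨
      (∑ λ i₁ → ∑ {n} λ i₂ → rowCost i₁ i₁) + (∑ {n} λ i₁ → ∑ λ i₂ → rowCost i₂ i₂)
        ≈⟨ ∑∑-distrib-+ (λ i₁ i₂ → rowCost i₁ i₁) (λ i₁ i₂ → rowCost i₂ i₂) ⟨
      (∑ λ i₁ → ∑ λ i₂ → rowCost i₁ i₁ + rowCost i₂ i₂)
        ≲⟨ ∑-mono-≤ (λ i₁ → ∑-mono-≤ λ i₂ → pair i₁ i₂) ⟩
      (∑ λ i₁ → ∑ λ i₂ → rowCost i₁ i₂ + rowCost i₂ i₁)
        ≈⟨ ∑∑-distrib-+ (λ i₁ i₂ → rowCost i₁ i₂) (λ i₁ i₂ → rowCost i₂ i₁) ⟩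
      (∑ λ i₁ → ∑ λ i₂ → rowCost i₁ i₂) + (∑ λ i₁ → ∑ λ i₂ → rowCost i₂ i₁)
        ≈⟨ +-cong ∑∑-rowCost (trans (∑-comm (λ i₁ i₂ → rowCost i₂ i₁)) ∑∑-rowCost) ⟩
      (∑ λ i → ∑ λ j → a i j) + (∑ λ i → ∑ λ j → a i j)
        ≈⟨ +-congˡ (+-identityʳ _) ⟨
      2 · (∑ λ i → ∑ λ j → a i j)
        ∎)
      where
      open ≤-Reasoning

      ∑∑-distrib-+ : ∀ (f g : Fin n → Fin n → Carrier) →
        (∑ λ i → ∑ λ j → f i j + g i j) ≈ (∑ λ i → ∑ λ j → f i j) + (∑ λ i → ∑ λ j → g i j)
      ∑∑-distrib-+ f g = trans (∑-cong λ i → ∑-distrib-+ (f i) (g i)) (∑-distrib-+ (λ i → ∑ (f i)) (λ i → ∑ (g i)))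

      left : (∑ λ i₁ → ∑ {n} λ i₂ → rowCost i₁ i₁) ≈ n · cost a x
      left = trans (∑-cong λ i → ∑-const n (rowCost i i)) (sym (·-∑ n (λ i → rowCost i i)))

      right : (∑ {n} λ i₁ → ∑ λ i₂ → rowCost i₂ i₂) ≈ n · cost a x
      right = ∑-const n (cost a x)

      pair : ∀ i₁ i₂ → rowCost i₁ i₁ + rowCost i₂ i₂ ≤ rowCost i₁ i₂ + rowCost i₂ i₁
      pair i₁ i₂ with i₁ Fin.≟ i₂
      ... | yes ≡.refl = ≤-refl
      -- With `cost a x` added to both sides, optimality replaces it by the cost of the swapped
      -- matrix, which `cost-transpose` then turns back into `cost a x` plus the crossed terms.
      ... | no i₁≢i₂   = +-cancelʳ-≤ (cost a x) (begin
        rowCost i₁ i₁ + rowCost i₂ i₂ + cost a x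
          ≲⟨ +-mono-≤ ≤-refl (optimal (permuteRows (transpose i₁ i₂) x) (swap-transpose x x-perm i₁≢i₂)) ⟩
        rowCost i₁ i₁ + rowCost i₂ i₂ + cost a (permuteRows (transpose i₁ i₂) x)
          ≈⟨ +-comm (rowCost i₁ i₁ + rowCost i₂ i₂) (cost a (permuteRows (transpose i₁ i₂) x)) ⟩
        cost a (permuteRows (transpose i₁ i₂) x) + (rowCost i₁ i₁ + rowCost i₂ i₂)
          ≈⟨ cost-transpose i₁≢i₂ ⟩
        cost a x + (rowCost i₁ i₂ + rowCost i₂ i₁)
          ≈⟨ +-comm (cost a x) (rowCost i₁ i₂ + rowCost i₂ i₁) ⟩
        rowCost i₁ i₂ + rowCost i₂ i₁ + cost a x
          ∎)

  -- Sums over lists and cleared denominators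

  -- A fold after `map`, the shape in which `mean` sums the list of objective values.
  ∑ₗ : ∀ {A : Set} → (A → Carrier) → List A → Carrier
  ∑ₗ f xs = foldr _+_ 0# (map f xs)

  module _ {A : Set} where

    -- The membership hypothesis lets `f x ≈ g x` rely on a listed `x` being a permutation matrix.
    ∑ₗ-cong : ∀ {f g : A → Carrier} xs → (∀ {x} → x ∈ xs → f x ≈ g x) → ∑ₗ f xs ≈ ∑ₗ g xs
    ∑ₗ-cong []       f≈g = refl
    ∑ₗ-cong (x ∷ xs) f≈g = +-cong (f≈g (here ≡.refl)) (∑ₗ-cong xs λ x∈ → f≈g (there x∈))

    ∑ₗ-mono-≤ : ∀ {f g : A → Carrier} → (∀ x → f x ≤ g x) → ∀ xs → ∑ₗ f xs ≤ ∑ₗ g xs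
    ∑ₗ-mono-≤ f≤g []       = ≤-refl
    ∑ₗ-mono-≤ f≤g (x ∷ xs) = +-mono-≤ (f≤g x) (∑ₗ-mono-≤ f≤g xs)

    ∑ₗ-++ : ∀ (f : A → Carrier) xs ys → ∑ₗ f (xs ++ ys) ≈ ∑ₗ f xs + ∑ₗ f ys
    ∑ₗ-++ f []       ys = sym (+-identityˡ _)
    ∑ₗ-++ f (x ∷ xs) ys = trans (+-congˡ (∑ₗ-++ f xs ys)) (sym (+-assoc (f x) (∑ₗ f xs) (∑ₗ f ys)))

    ∑ₗ-map : ∀ {B : Set} (f : A → Carrier) (g : B → A) xs → ∑ₗ f (map g xs) ≈ ∑ₗ (λ x → f (g x)) xs
    ∑ₗ-map f g xs = reflexive (cong (foldr _+_ 0#) (≡.sym (List.map-∘ xs)))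

    ∑ₗ-∑ : ∀ {n} (f : A → Fin n → Carrier) xs → ∑ₗ (λ x → ∑ (f x)) xs ≈ (∑ λ i → ∑ₗ (λ x → f x i) xs)
    ∑ₗ-∑ {n} f []       = sym (∑-zero n)
    ∑ₗ-∑     f (x ∷ xs) = trans (+-congˡ (∑ₗ-∑ f xs)) (sym (∑-distrib-+ (f x) (λ i → ∑ₗ (λ x → f x i) xs)))

    ∑ₗ-*ˡ : ∀ c (f : A → Carrier) xs → ∑ₗ (λ x → c * f x) xs ≈ c * ∑ₗ f xs
    ∑ₗ-*ˡ c f []       = sym (zeroʳ c)
    ∑ₗ-*ˡ c f (x ∷ xs) = trans (+-congˡ (∑ₗ-*ˡ c f xs)) (sym (distribˡ c (f x) (∑ₗ f xs)))

    ·-∑ₗ : ∀ k (f : A → Carrier) xs → k · ∑ₗ f xs ≈ ∑ₗ (λ x → k · f x) xs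
    ·-∑ₗ k f []       = trans (sym (∑-const k 0#)) (∑-zero k)
    ·-∑ₗ k f (x ∷ xs) = trans (·-distrib-+ (f x) (∑ₗ f xs) k) (+-congˡ (·-∑ₗ k f xs))

    ∑ₗ-const : ∀ c (xs : List A) → ∑ₗ (λ _ → c) xs ≈ length xs · c
    ∑ₗ-const c []       = refl
    ∑ₗ-const c (x ∷ xs) = +-congˡ (∑ₗ-const c xs)

    ∑ₗ-↭ : ∀ (f : A → Carrier) {xs ys} → xs ↭ ys → ∑ₗ f xs ≈ ∑ₗ f ys
    ∑ₗ-↭ f ↭.refl                     = refl
    ∑ₗ-↭ f (↭.prep x p)               = +-congˡ (∑ₗ-↭ f p)
    ∑ₗ-↭ f (↭.swap {xs} {ys} x y p)   = trans (+-congˡ (+-congˡ (∑ₗ-↭ f p))) (x∙yz≈y∙xz (f x) (f y) (∑ₗ f ys))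
    ∑ₗ-↭ f (↭.trans p q)              = trans (∑ₗ-↭ f p) (∑ₗ-↭ f q)

  ∑ₗ-cartesianProduct : ∀ {A B : Set} (f : A × B → Carrier) xs ys →
    ∑ₗ f (cartesianProduct xs ys) ≈ ∑ₗ (λ x → ∑ₗ (λ y → f (x , y)) ys) xs
  ∑ₗ-cartesianProduct f []       ys = refl
  ∑ₗ-cartesianProduct f (x ∷ xs) ys = begin
    ∑ₗ f (map (x ,_) ys ++ cartesianProduct xs ys)
      ≈⟨ ∑ₗ-++ f (map (x ,_) ys) (cartesianProduct xs ys) ⟩
    ∑ₗ f (map (x ,_) ys) + ∑ₗ f (cartesianProduct xs ys)
      ≈⟨ +-cong (∑ₗ-map f (x ,_) ys) (∑ₗ-cartesianProduct f xs ys) ⟩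
    ∑ₗ (λ y → f (x , y)) ys + ∑ₗ (λ x → ∑ₗ (λ y → f (x , y)) ys) xs
      ∎
    where open ≈-Reasoning

  ·-∑∑ : ∀ k {n} (f : Fin n → Fin n → Carrier) → k · (∑ λ i → ∑ λ j → f i j) ≈ (∑ λ i → ∑ λ j → k · f i j)
  ·-∑∑ k f = trans (·-∑ k λ i → ∑ (f i)) (∑-cong λ i → ·-∑ k (f i))

  ·-comm : ∀ k l x → k · (l · x) ≈ l · (k · x)
  ·-comm k l x = trans (·-assocˡ x k l)
    (trans (reflexive (cong (_· x) (ℕ.*-comm k l))) (sym (·-assocˡ x l k)))

  -- To be read with `L` the number of feasible solutions, `t` the sum of their values, `y` the
  -- mean, `p / k` the approximation ratio and `z` the ratio times the mean. All divisions are
  -- stated as multiples, so only `L` and `k` have to be cancelled.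
  scaled-≤-mean : ∀ L {k p x y z t} .{{_ : NonZero L}} .{{_ : NonZero k}} →
    L · k · x ≤ p · t → L · y ≈ t → k · z ≈ p · y → x ≤ z
  scaled-≤-mean L {k} {p} {x} {y} {z} {t} Lkx≤pt Ly≈t kz≈py = ·-cancelˡ-≤ k (·-cancelˡ-≤ L (begin
    L · k · x  ≲⟨ Lkx≤pt ⟩
    p · t      ≈⟨ ·-congʳ p Ly≈t ⟨
    p · L · y  ≈⟨ ·-comm p L y ⟩
    L · p · y  ≈⟨ ·-congʳ L kz≈py ⟨
    L · k · z  ∎))
    where open ≤-Reasoning

  -- Total cost over all permutation matrices

  -- Column `j` stays fixed while rows are exchanged: its `n` positions have equal counts, and these
  -- add up to one per matrix.
  ∑ₗ-entry : ∀ {n} (i j : Fin n) →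
    n · ∑ₗ (λ x → ⟦ entry x i j ⟧) (permutationMatrices n) ≈ length (permutationMatrices n) · 1#
  ∑ₗ-entry {n} i j = begin
    n · count i
      ≈⟨ ∑-const n (count i) ⟨
    (∑ {n} λ _ → count i)
      ≈⟨ ∑-cong row-independent ⟩
    (∑ λ i′ → count i′)
      ≈⟨ ∑ₗ-∑ (λ x i′ → ⟦ entry x i′ j ⟧) (permutationMatrices n) ⟨
    ∑ₗ (λ x → ∑ λ i′ → ⟦ entry x i′ j ⟧) (permutationMatrices n)
      ≈⟨ ∑ₗ-cong (permutationMatrices n) (λ {x} x∈ → ∑-⟦∃!⟧ (proj₂ (∈-permutationMatrices⁻ {x = x} x∈) j)) ⟩
    ∑ₗ (λ _ → 1#) (permutationMatrices n)
      ≈⟨ ∑ₗ-const 1# (permutationMatrices n) ⟩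
    length (permutationMatrices n) · 1#
      ∎
    where
    open ≈-Reasoning

    count : Fin n → Carrier
    count i = ∑ₗ (λ x → ⟦ entry x i j ⟧) (permutationMatrices n)

    row-independent : ∀ i′ → count i ≈ count i′
    row-independent i′ = begin
      count i
        ≈⟨ ∑ₗ-↭ (λ x → ⟦ entry x i j ⟧) (map-permuteRows-↭ π) ⟨
      ∑ₗ (λ x → ⟦ entry x i j ⟧) (map (permuteRows π) (permutationMatrices n))
        ≈⟨ ∑ₗ-map (λ x → ⟦ entry x i j ⟧) (permuteRows π) (permutationMatrices n) ⟩
      ∑ₗ (λ x → ⟦ entry (permuteRows π x) i j ⟧) (permutationMatrices n)
        ≈⟨ ∑ₗ-cong (permutationMatrices n) (λ {x} _ → reflexive (cong ⟦_⟧ (≡.trans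
             (entry-permuteRows π x i j) (cong (λ k → entry x k j) (transpose-first i i′))))) ⟩
      count i′
        ∎
      where
      π : Permutation′ n
      π = transpose i i′

  ∑ₗ-cost : ∀ {n} (a : Fin n → Fin n → Carrier) →
    n · ∑ₗ (cost a) (permutationMatrices n) ≈ length (permutationMatrices n) · (∑ λ i → ∑ λ j → a i j)
  ∑ₗ-cost {n} a = begin
    n · ∑ₗ (cost a) xs
      ≈⟨ ·-congʳ n (∑ₗ-∑ (λ x i → ∑ λ j → a i j * ⟦ entry x i j ⟧) xs) ⟩
    n · (∑ λ i → ∑ₗ (λ x → ∑ λ j → a i j * ⟦ entry x i j ⟧) xs)
      ≈⟨ ·-congʳ n (∑-cong λ i → ∑ₗ-∑ (λ x j → a i j * ⟦ entry x i j ⟧) xs) ⟩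
    n · (∑ λ i → ∑ λ j → ∑ₗ (λ x → a i j * ⟦ entry x i j ⟧) xs)
      ≈⟨ ·-∑∑ n (λ i j → ∑ₗ (λ x → a i j * ⟦ entry x i j ⟧) xs) ⟩
    (∑ λ i → ∑ λ j → n · ∑ₗ (λ x → a i j * ⟦ entry x i j ⟧) xs)
      ≈⟨ (∑-cong λ i → ∑-cong λ j → term i j) ⟩
    (∑ λ i → ∑ λ j → length xs · a i j)
      ≈⟨ ·-∑∑ (length xs) a ⟨
    length xs · (∑ λ i → ∑ λ j → a i j)
      ∎
    where
    open ≈-Reasoning

    xs : List (BinMatrix n)
    xs = permutationMatrices n

    term : ∀ i j → n · ∑ₗ (λ x → a i j * ⟦ entry x i j ⟧) xs ≈ length xs · a i j
    term i j = begin
      n · ∑ₗ (λ x → a i j * ⟦ entry x i j ⟧) xs    ≈⟨ ·-congʳ n (∑ₗ-*ˡ (a i j) (λ x → ⟦ entry x i j ⟧) xs) ⟩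
      n · (a i j * ∑ₗ (λ x → ⟦ entry x i j ⟧) xs)  ≈⟨ ·-comm-* n (a i j) _ ⟨
      a i j * (n · ∑ₗ (λ x → ⟦ entry x i j ⟧) xs)  ≈⟨ *-congˡ (∑ₗ-entry i j) ⟩
      a i j * (length xs · 1#)                     ≈⟨ ·-comm-* (length xs) (a i j) 1# ⟩
      length xs · (a i j * 1#)                     ≈⟨ ·-congʳ (length xs) (*-identityʳ (a i j)) ⟩
      length xs · a i j                            ∎

  -- Each factor `⟦ entry x i j ⟧` is 0 or 1, so a case split replaces monotonicity of products. It
  -- serves to compare the linear terms with those of the zero matrix.
  cost-mono-≤ : ∀ {n} {a b : Fin n → Fin n → Carrier} → (∀ i j → a i j ≤ b i j) → ∀ x → cost a x ≤ cost b x
  cost-mono-≤ {a = a} {b} a≤b x = ∑-mono-≤ λ i → ∑-mono-≤ λ j → *⟦⟧-mono-≤ (entry x i j) (a≤b i j)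
    where
    open ≤-Reasoning
    *⟦⟧-mono-≤ : ∀ β {u v} → u ≤ v → u * ⟦ β ⟧ ≤ v * ⟦ β ⟧
    *⟦⟧-mono-≤ true  {u} {v} u≤v = begin
      u * 1#  ≈⟨ *-identityʳ u ⟩
      u       ≲⟨ u≤v ⟩
      v       ≈⟨ *-identityʳ v ⟨
      v * 1#  ∎
    *⟦⟧-mono-≤ false {u} {v} _ = ≤-reflexive (trans (zeroʳ u) (sym (zeroʳ v)))

  cost-zero : ∀ {n} (x : BinMatrix n) → cost (λ _ _ → 0#) x ≈ 0#
  cost-zero {n} x = trans
    (∑-cong λ i → trans (∑-cong λ j → zeroˡ ⟦ entry x i j ⟧) (∑-zero n))
    (∑-zero n)

  -- Dropping the 0/1 factor can only enlarge a non-negative term. The non-negativity of `Q` enters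
  -- the theorem through this lemma alone.
  cost≤∑∑ : ∀ {n} {a : Fin n → Fin n → Carrier} → (∀ i j → 0# ≤ a i j) → ∀ x → cost a x ≤ (∑ λ i → ∑ λ j → a i j)
  cost≤∑∑ {a = a} 0≤a x = ∑-mono-≤ λ i → ∑-mono-≤ λ j → *⟦⟧-≤ (entry x i j) (0≤a i j)
    where
    *⟦⟧-≤ : ∀ β {u} → 0# ≤ u → u * ⟦ β ⟧ ≤ u
    *⟦⟧-≤ true  {u} _   = ≤-reflexive (*-identityʳ u)
    *⟦⟧-≤ false {u} 0≤u = ≤-trans (≤-reflexive (zeroʳ u)) 0≤u

  -- The bilinear objective

  module _ {m n : ℕ} (q : Fin m → Fin m → Fin n → Fin n → Carrier) where

    quadratic : Solution m n → Carrier
    quadratic (x , y) = ∑ λ i → ∑ λ j → ∑ λ k → ∑ λ l → q i j k l * ⟦ entry x i j ⟧ * ⟦ entry y k l ⟧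

    total : Carrier
    total = ∑ λ i → ∑ λ j → ∑ λ k → ∑ λ l → q i j k l

    -- Fixing `y` leaves a linear assignment problem in `x`, to which the results on `cost` apply.
    quadratic≈costˡ : ∀ x y → quadratic (x , y) ≈ cost (λ i j → cost (q i j) y) x
    quadratic≈costˡ x y = ∑-cong λ i → ∑-cong λ j → begin
      (∑ λ k → ∑ λ l → q i j k l * ⟦ entry x i j ⟧ * ⟦ entry y k l ⟧)
        ≈⟨ (∑-cong λ k → ∑-cong λ l → xy∙z≈xz∙y (q i j k l) ⟦ entry x i j ⟧ ⟦ entry y k l ⟧) ⟩
      (∑ λ k → ∑ λ l → q i j k l * ⟦ entry y k l ⟧ * ⟦ entry x i j ⟧)
        ≈⟨ ∑-cong (λ k → *-distribʳ-sum ⟦ entry x i j ⟧ (λ l → q i j k l * ⟦ entry y k l ⟧)) ⟨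
      (∑ λ k → (∑ λ l → q i j k l * ⟦ entry y k l ⟧) * ⟦ entry x i j ⟧)
        ≈⟨ *-distribʳ-sum ⟦ entry x i j ⟧ (λ k → ∑ λ l → q i j k l * ⟦ entry y k l ⟧) ⟨
      cost (q i j) y * ⟦ entry x i j ⟧
        ∎
      where open ≈-Reasoning

    quadratic≈costʳ : ∀ x y → quadratic (x , y) ≈ cost (λ k l → cost (λ i j → q i j k l) x) y
    quadratic≈costʳ x y = trans
      (∑∑-comm λ i j k l → q i j k l * ⟦ entry x i j ⟧ * ⟦ entry y k l ⟧)
      (∑-cong λ k → ∑-cong λ l → begin
        (∑ λ i → ∑ λ j → q i j k l * ⟦ entry x i j ⟧ * ⟦ entry y k l ⟧)
          ≈⟨ ∑-cong (λ i → *-distribʳ-sum ⟦ entry y k l ⟧ (λ j → q i j k l * ⟦ entry x i j ⟧)) ⟨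
        (∑ λ i → (∑ λ j → q i j k l * ⟦ entry x i j ⟧) * ⟦ entry y k l ⟧)
          ≈⟨ *-distribʳ-sum ⟦ entry y k l ⟧ (λ i → ∑ λ j → q i j k l * ⟦ entry x i j ⟧) ⟨
        cost (λ i j → q i j k l) x * ⟦ entry y k l ⟧
          ∎)
      where open ≈-Reasoning

    -- `∑ₗ-cost` is used twice: for each `x`, summing over `y` frees the indices `k`, `l`; then, for
    -- each `k` and `l`, what remains is linear in `x` and is summed in the same way.
    ∑ₗ-quadratic : (m ℕ.* n) · ∑ₗ quadratic feasibleSolutions ≈
      (length (permutationMatrices m) ℕ.* length (permutationMatrices n)) · total
    ∑ₗ-quadratic = begin
      (m ℕ.* n) · ∑ₗ quadratic feasibleSolutions
        ≈⟨ ·-assocˡ _ m n ⟨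
      m · (n · ∑ₗ quadratic feasibleSolutions)
        ≈⟨ ·-congʳ m (·-congʳ n (∑ₗ-cartesianProduct quadratic xs ys)) ⟩
      m · (n · ∑ₗ (λ x → ∑ₗ (λ y → quadratic (x , y)) ys) xs)
        ≈⟨ ·-congʳ m (·-∑ₗ n (λ x → ∑ₗ (λ y → quadratic (x , y)) ys) xs) ⟩
      m · ∑ₗ (λ x → n · ∑ₗ (λ y → quadratic (x , y)) ys) xs
        ≈⟨ ·-congʳ m (∑ₗ-cong xs λ {x} _ → trans
             (·-congʳ n (∑ₗ-cong ys λ {y} _ → quadratic≈costʳ x y))
             (∑ₗ-cost (λ k l → cost (λ i j → q i j k l) x))) ⟩
      m · ∑ₗ (λ x → length ys · (∑ λ k → ∑ λ l → cost (λ i j → q i j k l) x)) xs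
        ≈⟨ ·-congʳ m (·-∑ₗ (length ys) (λ x → ∑ λ k → ∑ λ l → cost (λ i j → q i j k l) x) xs) ⟨
      m · (length ys · ∑ₗ (λ x → ∑ λ k → ∑ λ l → cost (λ i j → q i j k l) x) xs)
        ≈⟨ ·-congʳ m (·-congʳ (length ys) (trans
             (∑ₗ-∑ (λ x k → ∑ λ l → cost (λ i j → q i j k l) x) xs)
             (∑-cong λ k → ∑ₗ-∑ (λ x l → cost (λ i j → q i j k l) x) xs))) ⟩
      m · (length ys · (∑ λ k → ∑ λ l → ∑ₗ (cost (λ i j → q i j k l)) xs))
        ≈⟨ ·-comm m (length ys) _ ⟩
      length ys · (m · (∑ λ k → ∑ λ l → ∑ₗ (cost (λ i j → q i j k l)) xs))
        ≈⟨ ·-congʳ (length ys) (·-∑∑ m (λ k l → ∑ₗ (cost (λ i j → q i j k l)) xs)) ⟩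
      length ys · (∑ λ k → ∑ λ l → m · ∑ₗ (cost (λ i j → q i j k l)) xs)
        ≈⟨ ·-congʳ (length ys) (∑-cong λ k → ∑-cong λ l → ∑ₗ-cost (λ i j → q i j k l)) ⟩
      length ys · (∑ λ k → ∑ λ l → length xs · (∑ λ i → ∑ λ j → q i j k l))
        ≈⟨ ·-congʳ (length ys) (·-∑∑ (length xs) (λ k l → ∑ λ i → ∑ λ j → q i j k l)) ⟨
      length ys · (length xs · (∑ λ k → ∑ λ l → ∑ λ i → ∑ λ j → q i j k l))
        ≈⟨ ·-congʳ (length ys) (·-congʳ (length xs) (∑∑-comm q)) ⟨
      length ys · (length xs · total)
        ≈⟨ ·-comm (length ys) (length xs) total ⟩
      length xs · (length ys · total)
        ≈⟨ ·-assocˡ total (length xs) (length ys) ⟩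
      (length xs ℕ.* length ys) · total
        ∎
      where
      open ≈-Reasoning
      xs = permutationMatrices m
      ys = permutationMatrices n

    module _ (0≤q : ∀ i j k l → 0# ≤ q i j k l) x y (x-perm : IsPermutationMatrix x) (y-perm : IsPermutationMatrix y)
             (x-optimal : ∀ x′ → Swap x x′ → quadratic (x , y) ≤ quadratic (x′ , y))
             (y-optimal : ∀ y′ → Swap y y′ → quadratic (x , y) ≤ quadratic (x , y′)) where

      open ≤-Reasoning

      x-optimal⇒≤total : m · quadratic (x , y) ≤ total
      x-optimal⇒≤total = begin
        m · quadratic (x , y)
          ≈⟨ ·-congʳ m (quadratic≈costˡ x y) ⟩
        m · cost (λ i j → cost (q i j) y) x
          ≲⟨ swap-optimal⇒cost≤ x x-perm (λ x′ swap → begin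
               cost (λ i j → cost (q i j) y) x   ≈⟨ quadratic≈costˡ x y ⟨
               quadratic (x , y)                 ≲⟨ x-optimal x′ swap ⟩
               quadratic (x′ , y)                ≈⟨ quadratic≈costˡ x′ y ⟩
               cost (λ i j → cost (q i j) y) x′  ∎) ⟩
        (∑ λ i → ∑ λ j → cost (q i j) y)
          ≲⟨ (∑-mono-≤ λ i → ∑-mono-≤ λ j → cost≤∑∑ (0≤q i j) y) ⟩
        total
          ∎

      y-optimal⇒≤total : n · quadratic (x , y) ≤ total
      y-optimal⇒≤total = begin
        n · quadratic (x , y)
          ≈⟨ ·-congʳ n (quadratic≈costʳ x y) ⟩
        n · cost (λ k l → cost (λ i j → q i j k l) x) y
          ≲⟨ swap-optimal⇒cost≤ y y-perm (λ y′ swap → begin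
               cost (λ k l → cost (λ i j → q i j k l) x) y   ≈⟨ quadratic≈costʳ x y ⟨
               quadratic (x , y)                             ≲⟨ y-optimal y′ swap ⟩
               quadratic (x , y′)                            ≈⟨ quadratic≈costʳ x y′ ⟩
               cost (λ k l → cost (λ i j → q i j k l) x) y′  ∎) ⟩
        (∑ λ k → ∑ λ l → cost (λ i j → q i j k l) x)
          ≲⟨ (∑-mono-≤ λ k → ∑-mono-≤ λ l → cost≤∑∑ (λ i j → 0≤q i j k l) x) ⟩
        (∑ λ k → ∑ λ l → ∑ λ i → ∑ λ j → q i j k l)
          ≈⟨ ∑∑-comm q ⟨
        total
          ∎

      optimal⇒≤2total : (m ℕ.+ n) · quadratic (x , y) ≤ 2 · total
      optimal⇒≤2total = begin
        (m ℕ.+ n) · quadratic (x , y)                  ≈⟨ ·-homo-+ _ m n ⟩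
        m · quadratic (x , y) + n · quadratic (x , y)  ≲⟨ +-mono-≤ x-optimal⇒≤total y-optimal⇒≤total ⟩
        total + total                                  ≈⟨ +-congˡ (+-identityʳ total) ⟨
        2 · total                                      ∎

    bilinearObjective : (Fin m → Fin m → Carrier) → (Fin n → Fin n → Carrier) → Solution m n → Carrier
    bilinearObjective c d s@(x , y) = quadratic s + cost c x + cost d y

    module _ {c : Fin m → Fin m → Carrier} {d : Fin n → Fin n → Carrier}
             (c≤0 : ∀ i j → c i j ≤ 0#) (0≤c : ∀ i j → 0# ≤ c i j)
             (d≤0 : ∀ k l → d k l ≤ 0#) (0≤d : ∀ k l → 0# ≤ d k l) where

      open ≤-Reasoning

      bilinearObjective≤quadratic : ∀ s → bilinearObjective c d s ≤ quadratic s
      bilinearObjective≤quadratic s@(x , y) = begin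
        quadratic s + cost c x + cost d y
          ≲⟨ +-mono-≤ (+-mono-≤ ≤-refl (cost-mono-≤ c≤0 x)) (cost-mono-≤ d≤0 y) ⟩
        quadratic s + cost (λ _ _ → 0#) x + cost (λ _ _ → 0#) y
          ≈⟨ +-cong (+-congˡ (cost-zero x)) (cost-zero y) ⟩
        quadratic s + 0# + 0#
          ≈⟨ trans (+-identityʳ _) (+-identityʳ _) ⟩
        quadratic s
          ∎

      quadratic≤bilinearObjective : ∀ s → quadratic s ≤ bilinearObjective c d s
      quadratic≤bilinearObjective s@(x , y) = begin
        quadratic s
          ≈⟨ trans (+-identityʳ _) (+-identityʳ _) ⟨
        quadratic s + 0# + 0#
          ≈⟨ +-cong (+-congˡ (cost-zero x)) (cost-zero y) ⟨
        quadratic s + cost (λ _ _ → 0#) x + cost (λ _ _ → 0#) y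
          ≲⟨ +-mono-≤ (+-mono-≤ ≤-refl (cost-mono-≤ 0≤c x)) (cost-mono-≤ 0≤d y) ⟩
        quadratic s + cost c x + cost d y
          ∎

      -- The claimed bound multiplied by m + n and by the number of feasible solutions, which leaves
      -- only natural coefficients.
      optimal⇒≤∑ₗ : (∀ i j k l → 0# ≤ q i j k l) → ∀ s → Feasible s →
        (∀ s′ → 2-exchange s s′ → bilinearObjective c d s ≤ bilinearObjective c d s′) →
        (length (permutationMatrices m) ℕ.* length (permutationMatrices n)) · (m ℕ.+ n) · bilinearObjective c d s ≤
        (2 ℕ.* m ℕ.* n) · ∑ₗ (bilinearObjective c d) feasibleSolutions
      optimal⇒≤∑ₗ 0≤q s@(x , y) (x-perm , y-perm) optimal = begin
        L · (m ℕ.+ n) · bilinearObjective c d s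
          ≲⟨ ·-mono-≤ L (·-mono-≤ (m ℕ.+ n) (bilinearObjective≤quadratic s)) ⟩
        L · (m ℕ.+ n) · quadratic s
          ≲⟨ ·-mono-≤ L (optimal⇒≤2total 0≤q x y x-perm y-perm
               (λ x′ swap → quadratic-optimal (x′ , y) (inj₁ (swap , ≡.refl)))
               (λ y′ swap → quadratic-optimal (x , y′) (inj₂ (≡.refl , swap)))) ⟩
        L · 2 · total
          ≈⟨ ·-comm L 2 total ⟩
        2 · L · total
          ≈⟨ ·-congʳ 2 ∑ₗ-quadratic ⟨
        2 · (m ℕ.* n) · ∑ₗ quadratic feasibleSolutions
          ≈⟨ ·-assocˡ _ 2 (m ℕ.* n) ⟩
        (2 ℕ.* (m ℕ.* n)) · ∑ₗ quadratic feasibleSolutions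
          ≡⟨ cong (_· ∑ₗ quadratic feasibleSolutions) (ℕ.*-assoc 2 m n) ⟨
        (2 ℕ.* m ℕ.* n) · ∑ₗ quadratic feasibleSolutions
          ≲⟨ ·-mono-≤ (2 ℕ.* m ℕ.* n) (∑ₗ-mono-≤ quadratic≤bilinearObjective feasibleSolutions) ⟩
        (2 ℕ.* m ℕ.* n) · ∑ₗ (bilinearObjective c d) feasibleSolutions
          ∎
        where
        L : ℕ
        L = length (permutationMatrices m) ℕ.* length (permutationMatrices n)

        quadratic-optimal : ∀ s′ → 2-exchange s s′ → quadratic s ≤ quadratic s′
        quadratic-optimal s′ exchange =
          ≤-trans (quadratic≤bilinearObjective s) (≤-trans (optimal s′ exchange) (bilinearObjective≤quadratic s′))

-- The reals as a preordered semiring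

open Defs using (_≈_; _≤_; _<_; _+_; _*_; ∑; ⟦_⟧)

private
  module _ where
    open +-*-Solver

    half-pos : ∀ {ε} → 0ℚ ℚ.< ε → 0ℚ ℚ.< ½ ℚ.* ε
    half-pos {ε} 0<ε = subst (ℚ._< ½ ℚ.* ε) (ℚ.*-zeroʳ ½) (ℚ.*-monoʳ-<-pos ½ 0<ε)

    half+half : ∀ p ε → p ℚ.+ ½ ℚ.* ε ℚ.+ ½ ℚ.* ε ≡ p ℚ.+ ε
    half+half = solve 2 (λ p e → p :+ con ½ :* e :+ con ½ :* e := p :+ e) ≡.refl

    p≤p+ε : ∀ p {ε} → 0ℚ ℚ.< ε → p ℚ.≤ p ℚ.+ ε
    p≤p+ε p {ε} 0<ε = subst (ℚ._≤ p ℚ.+ ε) (ℚ.+-identityʳ p) (ℚ.+-monoʳ-≤ p (ℚ.<⇒≤ 0<ε))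

    p≤∣p∣ : ∀ p → p ℚ.≤ ∣ p ∣
    p≤∣p∣ p with ℚ.≤-total 0ℚ p
    ... | inj₁ 0≤p = ℚ.≤-reflexive (≡.sym (ℚ.0≤p⇒∣p∣≡p 0≤p))
    ... | inj₂ p≤0 = ℚ.≤-trans p≤0 (ℚ.0≤∣p∣ p)

    close⇒≤ : ∀ p q {δ} → ∣ p ℚ.- q ∣ ℚ.< δ → p ℚ.≤ q ℚ.+ δ
    close⇒≤ p q {δ} d = begin
      p                   ≡⟨ solve 2 (λ p q → p := q :+ (p :- q)) ≡.refl p q ⟩
      q ℚ.+ (p ℚ.- q)     ≤⟨ ℚ.+-monoʳ-≤ q (ℚ.≤-trans (p≤∣p∣ (p ℚ.- q)) (ℚ.<⇒≤ d)) ⟩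
      q ℚ.+ δ             ∎
      where open ℚ.≤-Reasoning

    +-cancelʳ-≤ℚ : ∀ p q r → p ℚ.+ r ℚ.≤ q ℚ.+ r → p ℚ.≤ q
    +-cancelʳ-≤ℚ p q r h = subst₂ ℚ._≤_ (add-sub p r) (add-sub q r) (ℚ.+-monoˡ-≤ (ℚ.- r) h)
      where
      add-sub : ∀ p r → p ℚ.+ r ℚ.- r ≡ p
      add-sub = solve 2 (λ p r → p :+ r :- r := p) ≡.refl

    swap-last : ∀ p q r → p ℚ.+ q ℚ.+ r ≡ p ℚ.+ r ℚ.+ q
    swap-last = solve 3 (λ p q r → p :+ q :+ r := p :+ r :+ q) ≡.refl

    -- The error budget of `≮⇒≥`: a threshold of three quarters of `ε` and two variations of an
    -- eighth each.
    3η+2δ≡ε : ∀ p ε → let η = ½ ℚ.* (½ ℚ.* ε) in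
      p ℚ.+ ½ ℚ.* η ℚ.+ (η ℚ.+ η ℚ.+ η) ℚ.+ ½ ℚ.* η ≡ p ℚ.+ ε
    3η+2δ≡ε = solve 2 (λ p e → let h = con ½ :* (con ½ :* e) in
      p :+ con ½ :* h :+ (h :+ h :+ h) :+ con ½ :* h := p :+ e) ≡.refl

-- Equality at every index is finer than _≈_, but makes ℝ a semiring without any ε.
infix 4 _≐_
record _≐_ (x y : ℝ) : Set where
  constructor pointwise
  field seq-≡ : ∀ i → seq x i ≡ seq y i
open _≐_

≐-isEquivalence : IsEquivalence _≐_
≐-isEquivalence = record
  { refl  = pointwise λ _ → ≡.refl
  ; sym   = λ p → pointwise λ i → ≡.sym (seq-≡ p i)
  ; trans = λ p q → pointwise λ i → ≡.trans (seq-≡ p i) (seq-≡ q i)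
  }

open IsEquivalence ≐-isEquivalence using () renaming (refl to ≐-refl; sym to ≐-sym; trans to ≐-trans)

-- Opaque copies of the operations keep conversion checking from unfolding the Cauchy proofs inside _+_ and _*_.
opaque
  infixl 6 _⊕_
  infixl 7 _⊗_

  _⊕_ _⊗_ : ℝ → ℝ → ℝ
  _⊕_ = _+_
  _⊗_ = _*_

  seq-⊕ : ∀ x y i → seq (x ⊕ y) i ≡ seq x i ℚ.+ seq y i
  seq-⊕ x y i = ≡.refl

  seq-⊗ : ∀ x y i → seq (x ⊗ y) i ≡ seq x i ℚ.* seq y i
  seq-⊗ x y i = ≡.refl

  ⊕-⊗-isCommutativeSemiring : IsCommutativeSemiring _≐_ _⊕_ _⊗_ 0ℝ 1ℝ
  ⊕-⊗-isCommutativeSemiring = isCommutativeSemiringˡ record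
    { +-isCommutativeMonoid = isCommutativeMonoidˡ record
      { isSemigroup = record
        { isMagma = record
          { isEquivalence = ≐-isEquivalence
          ; ∙-cong = λ p q → pointwise λ i → cong₂ ℚ._+_ (seq-≡ p i) (seq-≡ q i) }
        ; assoc = λ x y z → pointwise λ i → ℚ.+-assoc (seq x i) (seq y i) (seq z i) }
      ; identityˡ = λ x → pointwise λ i → ℚ.+-identityˡ (seq x i)
      ; comm = λ x y → pointwise λ i → ℚ.+-comm (seq x i) (seq y i) }
    ; *-isCommutativeMonoid = isCommutativeMonoidˡ record
      { isSemigroup = record
        { isMagma = record
          { isEquivalence = ≐-isEquivalence
          ; ∙-cong = λ p q → pointwise λ i → cong₂ ℚ._*_ (seq-≡ p i) (seq-≡ q i) }
        ; assoc = λ x y z → pointwise λ i → ℚ.*-assoc (seq x i) (seq y i) (seq z i) }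
      ; identityˡ = λ x → pointwise λ i → ℚ.*-identityˡ (seq x i)
      ; comm = λ x y → pointwise λ i → ℚ.*-comm (seq x i) (seq y i) }
    ; distribʳ = λ x y z → pointwise λ i → ℚ.*-distribʳ-+ (seq x i) (seq y i) (seq z i)
    ; zeroˡ = λ x → pointwise λ i → ℚ.*-zeroˡ (seq x i)
    }

  ⊕-mono-≤ : ∀ {x y u v} → x ≤ y → u ≤ v → x ⊕ u ≤ y ⊕ v
  ⊕-mono-≤ {x} {y} {u} {v} (*≤* x≤y) (*≤* u≤v) = *≤* λ ε 0<ε →
    let N₁ , p = x≤y (½ ℚ.* ε) (half-pos 0<ε)
        N₂ , q = u≤v (½ ℚ.* ε) (half-pos 0<ε)
    in N₁ ℕ.⊔ N₂ , λ {i} N≤i → begin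
      seq x i ℚ.+ seq u i
        ≤⟨ ℚ.+-mono-≤ (p (ℕ.m⊔n≤o⇒m≤o N₁ N₂ N≤i)) (q (ℕ.m⊔n≤o⇒n≤o N₁ N₂ N≤i)) ⟩
      (seq y i ℚ.+ ½ ℚ.* ε) ℚ.+ (seq v i ℚ.+ ½ ℚ.* ε)
        ≡⟨ regroup (seq y i) (seq v i) ε ⟩
      seq y i ℚ.+ seq v i ℚ.+ ε
        ∎
    where
    open ℚ.≤-Reasoning
    regroup : ∀ a b e → (a ℚ.+ ½ ℚ.* e) ℚ.+ (b ℚ.+ ½ ℚ.* e) ≡ a ℚ.+ b ℚ.+ e
    regroup = solve 3 (λ a b e → (a :+ con ½ :* e) :+ (b :+ con ½ :* e) := a :+ b :+ e) ≡.refl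
      where open +-*-Solver

  ⊕-cancelʳ-≤ : ∀ {x y} z → x ⊕ z ≤ y ⊕ z → x ≤ y
  ⊕-cancelʳ-≤ {x} {y} z (*≤* h) = *≤* λ ε 0<ε →
    let N , p = h ε 0<ε
    in N , λ {i} N≤i → +-cancelʳ-≤ℚ (seq x i) (seq y i ℚ.+ ε) (seq z i)
         (subst (seq x i ℚ.+ seq z i ℚ.≤_) (swap-last (seq y i) (seq z i) ε) (p N≤i))

≤-reflexive : ∀ {x y} → x ≐ y → x ≤ y
≤-reflexive {x} {y} x≐y = *≤* λ ε 0<ε → 0 , λ {i} _ →
  subst (ℚ._≤ seq y i ℚ.+ ε) (≡.sym (seq-≡ x≐y i)) (p≤p+ε (seq y i) 0<ε)

≤-trans : ∀ {x y z} → x ≤ y → y ≤ z → x ≤ z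
≤-trans {x} {y} {z} (*≤* x≤y) (*≤* y≤z) = *≤* λ ε 0<ε →
  let N₁ , p = x≤y (½ ℚ.* ε) (half-pos 0<ε)
      N₂ , q = y≤z (½ ℚ.* ε) (half-pos 0<ε)
  in N₁ ℕ.⊔ N₂ , λ {i} N≤i → begin
    seq x i                            ≤⟨ p (ℕ.m⊔n≤o⇒m≤o N₁ N₂ N≤i) ⟩
    seq y i ℚ.+ ½ ℚ.* ε                ≤⟨ ℚ.+-monoˡ-≤ _ (q (ℕ.m⊔n≤o⇒n≤o N₁ N₂ N≤i)) ⟩
    seq z i ℚ.+ ½ ℚ.* ε ℚ.+ ½ ℚ.* ε    ≡⟨ half+half (seq z i) ε ⟩
    seq z i ℚ.+ ε                      ∎
  where open ℚ.≤-Reasoning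

≈-sym : ∀ {x y} → x ≈ y → y ≈ x
≈-sym {x} {y} (*≈* h) = *≈* λ ε 0<ε →
  let N , p = h ε 0<ε
  in N , λ {i} N≤i → subst (ℚ._< ε) (∣p-q∣≡∣q-p∣ (seq x i) (seq y i)) (p N≤i)
  where
  ∣p-q∣≡∣q-p∣ : ∀ p q → ∣ p ℚ.- q ∣ ≡ ∣ q ℚ.- p ∣
  ∣p-q∣≡∣q-p∣ p q = ≡.trans (≡.sym (ℚ.∣-p∣≡∣p∣ (p ℚ.- q)))
    (cong ∣_∣ (solve 2 (λ p q → :- (p :- q) := q :- p) ≡.refl p q))
    where open +-*-Solver

≈⇒≤ : ∀ {x y} → x ≈ y → x ≤ y
≈⇒≤ {x} {y} (*≈* h) = *≤* λ ε 0<ε →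
  let N , p = h ε 0<ε
  in N , λ {i} N≤i → close⇒≤ (seq x i) (seq y i) (p N≤i)

-- The decidable order on ℚ separates the two cases at a single index N beyond which both sequences vary by less than ε / 8.
≮⇒≥ : ∀ {x y} → ¬ x < y → y ≤ x
≮⇒≥ {x} {y} x≮y = *≤* bound
  where
  open ℚ.≤-Reasoning
  bound : ∀ ε → 0ℚ ℚ.< ε → ∃[ N ] (∀ {i} → N ℕ.≤ i → seq y i ℚ.≤ seq x i ℚ.+ ε)
  bound ε 0<ε = main (cauchy x δ 0<δ) (cauchy y δ 0<δ)
    where
    η = ½ ℚ.* (½ ℚ.* ε)
    δ = ½ ℚ.* η
    0<η : 0ℚ ℚ.< η
    0<η = half-pos (half-pos 0<ε)
    0<δ : 0ℚ ℚ.< δ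
    0<δ = half-pos 0<η
    3η = η ℚ.+ η ℚ.+ η

    main : ∃[ N ] (∀ {i j} → N ℕ.≤ i → N ℕ.≤ j → ∣ seq x i ℚ.- seq x j ∣ ℚ.< δ) →
           ∃[ N ] (∀ {i j} → N ℕ.≤ i → N ℕ.≤ j → ∣ seq y i ℚ.- seq y j ∣ ℚ.< δ) →
           ∃[ N ] (∀ {i} → N ℕ.≤ i → seq y i ℚ.≤ seq x i ℚ.+ ε)
    main (N₁ , p) (N₂ , q) = N , settled
      where
      N = N₁ ℕ.⊔ N₂

      x-near : ∀ {i j} → N ℕ.≤ i → N ℕ.≤ j → seq x i ℚ.≤ seq x j ℚ.+ δ
      x-near {i} {j} N≤i N≤j = close⇒≤ (seq x i) (seq x j)
        (p (ℕ.m⊔n≤o⇒m≤o N₁ N₂ N≤i) (ℕ.m⊔n≤o⇒m≤o N₁ N₂ N≤j))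

      y-near : ∀ {i j} → N ℕ.≤ i → N ℕ.≤ j → seq y i ℚ.≤ seq y j ℚ.+ δ
      y-near {i} {j} N≤i N≤j = close⇒≤ (seq y i) (seq y j)
        (q (ℕ.m⊔n≤o⇒n≤o N₁ N₂ N≤i) (ℕ.m⊔n≤o⇒n≤o N₁ N₂ N≤j))

      settled : ∀ {i} → N ℕ.≤ i → seq y i ℚ.≤ seq x i ℚ.+ ε
      settled {i} N≤i with seq y N ℚ.≤? seq x N ℚ.+ 3η
      ... | yes yN≤ = begin
        seq y i                          ≤⟨ y-near N≤i ℕ.≤-refl ⟩
        seq y N ℚ.+ δ                    ≤⟨ ℚ.+-monoˡ-≤ δ yN≤ ⟩
        seq x N ℚ.+ 3η ℚ.+ δ             ≤⟨ ℚ.+-monoˡ-≤ δ (ℚ.+-monoˡ-≤ 3η (x-near ℕ.≤-refl N≤i)) ⟩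
        seq x i ℚ.+ δ ℚ.+ 3η ℚ.+ δ       ≡⟨ 3η+2δ≡ε (seq x i) ε ⟩
        seq x i ℚ.+ ε                    ∎
      ... | no yN≰ = contradiction x<y x≮y
        where
        x<y : x < y
        -- Moving from `N` to `j` costs `δ` in each sequence, together `η`; of the gap `3η` at `N`
        -- this leaves `η + η`.
        x<y = *<* (η ℚ.+ η , ℚ.+-mono-< 0<η 0<η , N , λ {j} N≤j →
          +-cancelʳ-≤ℚ (seq x j ℚ.+ (η ℚ.+ η)) (seq y j) η (begin
            seq x j ℚ.+ (η ℚ.+ η) ℚ.+ η    ≡⟨ ℚ.+-assoc (seq x j) (η ℚ.+ η) η ⟩
            seq x j ℚ.+ 3η                 ≤⟨ ℚ.+-monoˡ-≤ 3η (x-near N≤j ℕ.≤-refl) ⟩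
            seq x N ℚ.+ δ ℚ.+ 3η           ≡⟨ swap-last (seq x N) δ 3η ⟩
            seq x N ℚ.+ 3η ℚ.+ δ           ≤⟨ ℚ.+-monoˡ-≤ δ (ℚ.<⇒≤ (ℚ.≰⇒> yN≰)) ⟩
            seq y N ℚ.+ δ                  ≤⟨ ℚ.+-monoˡ-≤ δ (y-near ℕ.≤-refl N≤j) ⟩
            seq y j ℚ.+ δ ℚ.+ δ            ≡⟨ half+half (seq y j) η ⟩
            seq y j ℚ.+ η                  ∎))

-- Natural multiples and fractions

-- Since `ℚ./` reduces to lowest terms, it does not compute on a variable; the identity is checked
-- by cross-multiplying unnormalised fractions.
suc/1 : ∀ n → + suc n ℚ./ 1 ≡ 1ℚ ℚ.+ + n ℚ./ 1
suc/1 n = ℚ.toℚᵘ-injective (begin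
  toℚᵘ (+ suc n ℚ./ 1)              ≈⟨ ℚ.toℚᵘ-fromℚᵘ (mkℚᵘ (+ suc n) 0) ⟩
  mkℚᵘ (+ suc n) 0                  ≈⟨ *≡* (solve 1 (λ x → (con (+ 1) :+ x) :* con (+ 1) := (con (+ 1) :* con (+ 1) :+ x :* con (+ 1)) :* con (+ 1)) ≡.refl (+ n)) ⟩
  toℚᵘ 1ℚ ℚᵘ.+ mkℚᵘ (+ n) 0         ≈⟨ ℚᵘ.+-congʳ (toℚᵘ 1ℚ) (ℚ.toℚᵘ-fromℚᵘ (mkℚᵘ (+ n) 0)) ⟨
  toℚᵘ 1ℚ ℚᵘ.+ toℚᵘ (+ n ℚ./ 1)     ≈⟨ ℚ.toℚᵘ-homo-+ 1ℚ (+ n ℚ./ 1) ⟨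
  toℚᵘ (1ℚ ℚ.+ + n ℚ./ 1)           ∎)
  where
  open import Relation.Binary.Reasoning.Setoid ℚᵘ.≃-setoid
  open ℤ.+-*-Solver

k/1*p/k : ∀ k .{{_ : NonZero k}} p → + k ℚ./ 1 ℚ.* (+ p ℚ./ k) ≡ + p ℚ./ 1
k/1*p/k k@(suc k-1) p = ℚ.toℚᵘ-injective (begin
  toℚᵘ (+ k ℚ./ 1 ℚ.* (+ p ℚ./ k))          ≈⟨ ℚ.toℚᵘ-homo-* (+ k ℚ./ 1) (+ p ℚ./ k) ⟩
  toℚᵘ (+ k ℚ./ 1) ℚᵘ.* toℚᵘ (+ p ℚ./ k)    ≈⟨ ℚᵘ.*-cong (ℚ.toℚᵘ-fromℚᵘ (mkℚᵘ (+ k) 0)) (ℚ.toℚᵘ-fromℚᵘ (mkℚᵘ (+ p) k-1)) ⟩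
  mkℚᵘ (+ k) 0 ℚᵘ.* mkℚᵘ (+ p) k-1          ≈⟨ *≡* (solve 2 (λ k p → (k :* p) :* con (+ 1) := p :* (con (+ 1) :* k)) ≡.refl (+ k) (+ p)) ⟩
  mkℚᵘ (+ p) 0                              ≈⟨ ℚ.toℚᵘ-fromℚᵘ (mkℚᵘ (+ p) 0) ⟨
  toℚᵘ (+ p ℚ./ 1)                          ∎)
  where
  open import Relation.Binary.Reasoning.Setoid ℚᵘ.≃-setoid
  open ℤ.+-*-Solver

⊕-⊗-commutativeSemiring : CommutativeSemiring 0ℓ 0ℓ
⊕-⊗-commutativeSemiring = record { isCommutativeSemiring = ⊕-⊗-isCommutativeSemiring }

open RawMonoid (CommutativeSemiring.+-rawMonoid ⊕-⊗-commutativeSemiring) using () renaming (_×_ to infixr 7 _·_; sum to ∑⊕)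

-- Both the cancellation of `n ·` and the rational factors in `mean` and `ratio` are handled through
-- this formula.
seq-· : ∀ n x i → seq (n · x) i ≡ + n ℚ./ 1 ℚ.* seq x i
seq-· zero    x i = ≡.sym (ℚ.*-zeroˡ (seq x i))
seq-· (suc n) x i = begin
  seq (x ⊕ n · x) i                             ≡⟨ seq-⊕ x (n · x) i ⟩
  seq x i ℚ.+ seq (n · x) i                     ≡⟨ cong₂ ℚ._+_ (≡.sym (ℚ.*-identityˡ (seq x i))) (seq-· n x i) ⟩
  1ℚ ℚ.* seq x i ℚ.+ + n ℚ./ 1 ℚ.* seq x i      ≡⟨ ℚ.*-distribʳ-+ (seq x i) 1ℚ (+ n ℚ./ 1) ⟨
  (1ℚ ℚ.+ + n ℚ./ 1) ℚ.* seq x i                ≡⟨ cong (ℚ._* seq x i) (suc/1 n) ⟨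
  + suc n ℚ./ 1 ℚ.* seq x i                     ∎
  where open ≡.≡-Reasoning

-- The coefficient comes with an equation because `ratio m n` reduces only when `m` is a successor.
-- The case `p = 1` clears the denominator of `mean`.
·-fromℚ* : ∀ k .{{_ : NonZero k}} p {c} x → c ≡ + p ℚ./ k → k · (fromℚ c * x) ≐ p · x
·-fromℚ* k p {c} x c≡p/k = pointwise λ i → ≡.trans
  (seq-· k (fromℚ c * x) i)
  (≡.trans (≡.sym (ℚ.*-assoc (+ k ℚ./ 1) c (seq x i)))
  (≡.trans (cong (ℚ._* seq x i) (≡.trans (cong (+ k ℚ./ 1 ℚ.*_) c≡p/k) (k/1*p/k k p)))
           (≡.sym (seq-· p x i))))

·-cancelˡ-≤ : ∀ n .{{_ : NonZero n}} {x y} → n · x ≤ n · y → x ≤ y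
·-cancelˡ-≤ n@(suc _) {x} {y} (*≤* h) = *≤* λ ε 0<ε →
  -- The tolerance is scaled by `c` so that exactly `ε` is left after cancelling `c`.
  let N , p = h (c ℚ.* ε) (subst (ℚ._< c ℚ.* ε) (ℚ.*-zeroʳ c) (ℚ.*-monoʳ-<-pos c {{c>0}} 0<ε))
  in N , λ {i} N≤i → ℚ.*-cancelˡ-≤-pos c {{c>0}} (subst₂ ℚ._≤_
       (seq-· n x i)
       (≡.trans (cong (ℚ._+ c ℚ.* ε) (seq-· n y i)) (≡.sym (ℚ.*-distribˡ-+ c (seq y i) ε)))
       (p N≤i))
  where
  c : ℚ
  c = + n ℚ./ 1
  c>0 : ℚ.Positive c
  c>0 = ℚ.normalize-pos n 1

ℝ-preorderedSemiring : PreorderedSemiring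
ℝ-preorderedSemiring = record
  { commutativeSemiring = ⊕-⊗-commutativeSemiring
  ; _≤_         = _≤_
  ; isPreorder  = record { isEquivalence = ≐-isEquivalence ; reflexive = ≤-reflexive ; trans = ≤-trans }
  ; +-mono-≤    = ⊕-mono-≤
  ; +-cancelʳ-≤ = ⊕-cancelʳ-≤
  ; ·-cancelˡ-≤ = ·-cancelˡ-≤
  }

-- Transfer between the given operations and their opaque copies

module ℝ-Assignment = Assignment ℝ-preorderedSemiring

-- Congruence and change of operation in one step, so that the objective can be translated along its
-- own structure.
+-≐-⊕ : ∀ {x y u v} → x ≐ y → u ≐ v → x + u ≐ y ⊕ v
+-≐-⊕ {y = y} {v = v} p q = pointwise λ i → ≡.trans (cong₂ ℚ._+_ (seq-≡ p i) (seq-≡ q i)) (≡.sym (seq-⊕ y v i))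

*-≐-⊗ : ∀ {x y u v} → x ≐ y → u ≐ v → x * u ≐ y ⊗ v
*-≐-⊗ {y = y} {v = v} p q = pointwise λ i → ≡.trans (cong₂ ℚ._*_ (seq-≡ p i) (seq-≡ q i)) (≡.sym (seq-⊗ y v i))

foldr-+-≐-⊕ : ∀ xs → foldr _+_ 0ℝ xs ≐ foldr _⊕_ 0ℝ xs
foldr-+-≐-⊕ []       = ≐-refl
foldr-+-≐-⊕ (x ∷ xs) = +-≐-⊕ {x} {x} {foldr _+_ 0ℝ xs} ≐-refl (foldr-+-≐-⊕ xs)

∑-≐-∑⊕ : ∀ {n} {f g : Fin n → ℝ} → (∀ i → f i ≐ g i) → ∑ f ≐ ∑⊕ g
∑-≐-∑⊕ {zero}          p = ≐-refl
∑-≐-∑⊕ {suc n} {f} {g} p = pointwise λ i → ≡.trans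
  (cong₂ ℚ._+_ (seq-≡ (p zero) i) (seq-≡ (∑-≐-∑⊕ λ i → p (suc i)) i))
  (≡.sym (seq-⊕ (g zero) (∑⊕ λ i → g (suc i)) i))

⟦⟧-≐ : ∀ b → ⟦ b ⟧ ≐ ℝ-Assignment.⟦ b ⟧
⟦⟧-≐ true  = ≐-refl
⟦⟧-≐ false = ≐-refl

linear-≐-cost : ∀ {n} (a : Fin n → Fin n → ℝ) x →
  (∑ λ i → ∑ λ j → a i j * ⟦ entry x i j ⟧) ≐ ℝ-Assignment.cost a x
linear-≐-cost a x = ∑-≐-∑⊕ λ i → ∑-≐-∑⊕ λ j → *-≐-⊗ {a i j} {a i j} {⟦ entry x i j ⟧} ≐-refl (⟦⟧-≐ (entry x i j))

quadratic-≐ : ∀ {m n} (q : Fin m → Fin m → Fin n → Fin n → ℝ) x y →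
  (∑ λ i → ∑ λ j → ∑ λ k → ∑ λ l → q i j k l * ⟦ entry x i j ⟧ * ⟦ entry y k l ⟧) ≐ ℝ-Assignment.quadratic q (x , y)
quadratic-≐ q x y = ∑-≐-∑⊕ λ i → ∑-≐-∑⊕ λ j → ∑-≐-∑⊕ λ k → ∑-≐-∑⊕ λ l →
  *-≐-⊗ {q i j k l * ⟦ entry x i j ⟧} {_} {⟦ entry y k l ⟧}
    (*-≐-⊗ {q i j k l} {_} {⟦ entry x i j ⟧} ≐-refl (⟦⟧-≐ (entry x i j)))
    (⟦⟧-≐ (entry y k l))

-- For the empty list both sides are `0ℝ`, whatever value `mean` takes there. Otherwise the factor
-- cancels to `1 ·`, which unfolds to adding `0ℝ`.
length-·-mean : ∀ xs → length xs · mean xs ≐ foldr _⊕_ 0ℝ xs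
length-·-mean []          = ≐-refl
length-·-mean xs@(_ ∷ _) = ≐-trans
  (·-fromℚ* (length xs) 1 (foldr _+_ 0ℝ xs) ≡.refl)
  (≐-trans (CommutativeSemiring.+-identityʳ ⊕-⊗-commutativeSemiring (foldr _+_ 0ℝ xs)) (foldr-+-≐-⊕ xs))

length-feasibleSolutions : ∀ m n (f : Solution m n → ℝ) →
  length (map f feasibleSolutions) ≡ length (permutationMatrices m) ℕ.* length (permutationMatrices n)
length-feasibleSolutions m n f = ≡.trans
  (List.length-map f feasibleSolutions)
  (length-cartesianProductWith _,_ (permutationMatrices m) (permutationMatrices n))

-- The components of the given local optimum serve as witnesses, so no particular permutation matrix
-- has to be constructed.
permutationMatrices-nonZero : ∀ {n} {x : BinMatrix n} → IsPermutationMatrix x → NonZero (length (permutationMatrices n))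
permutationMatrices-nonZero {n} {x} x-perm = ∈⇒nonZero (∈-permutationMatrices⁺ {x = x} x-perm)
  where
  ∈⇒nonZero : ∀ {xs : List (BinMatrix n)} → x ∈ xs → NonZero (length xs)
  ∈⇒nonZero (here _)  = _
  ∈⇒nonZero (there _) = _

+-nonZeroˡ : ∀ m n .{{_ : NonZero m}} → NonZero (m ℕ.+ n)
+-nonZeroˡ (suc m) n = _

ratio≡ : ∀ m n .{{_ : NonZero m}} .{{_ : NonZero (m ℕ.+ n)}} → ratio m n ≡ + (2 ℕ.* m ℕ.* n) ℚ./ (m ℕ.+ n)
ratio≡ (suc m) n = ≡.refl

theorem7 : (m n : ℕ) .{{_ : NonZero m}} .{{_ : NonZero n}} → m ℕ.≤ n →
    (I : Instance m n) → let open Instance I in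
    (∀ i j k l → 0ℝ ≤ Q i j k l) →
    (∀ i j → C i j ≈ 0ℝ) →
    (∀ k l → D k l ≈ 0ℝ) →
    (s : Solution m n) → IsLocalOptimum 2-exchange I s →
    objective I s ≤ fromℚ (ratio m n) * average I
theorem7 m n m≤n I 0≤Q C≈0 D≈0 s@(x , y) (feasible@(x-perm , y-perm) , optimal) =
  ≤-trans {objective I s} {f s} {fromℚ (ratio m n) * average I} (≤-reflexive (objective-≐ s)) f≤ratio*average
  where
  open Instance I
  open ℝ-Assignment using (cost; quadratic; bilinearObjective; optimal⇒≤∑ₗ; scaled-≤-mean; ∑ₗ; ∑ₗ-cong)

  f : Solution m n → ℝ
  f = bilinearObjective Q C D

  objective-≐ : ∀ s → objective I s ≐ f s
  objective-≐ (x , y) = pointwise λ i → ≡.trans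
    (cong₂ ℚ._+_
      (≡.trans (cong₂ ℚ._+_ (seq-≡ (quadratic-≐ Q x y) i) (seq-≡ (linear-≐-cost C x) i))
               (≡.sym (seq-⊕ (quadratic Q (x , y)) (cost C x) i)))
      (seq-≡ (linear-≐-cost D y) i))
    (≡.sym (seq-⊕ (quadratic Q (x , y) ⊕ cost C x) (cost D y) i))

  L : ℕ
  L = length (permutationMatrices m) ℕ.* length (permutationMatrices n)

  L-nonZero : NonZero L
  L-nonZero = ℕ.m*n≢0 _ _ {{permutationMatrices-nonZero {x = x} x-perm}} {{permutationMatrices-nonZero {x = y} y-perm}}

  average-scaled : L · average I ≐ ∑ₗ f feasibleSolutions
  average-scaled = subst (λ k → k · average I ≐ ∑ₗ f feasibleSolutions)
    (length-feasibleSolutions m n (objective I))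
    (≐-trans (length-·-mean (map (objective I) feasibleSolutions))
             (∑ₗ-cong feasibleSolutions λ {s} _ → objective-≐ s))

  instance
    m+n-nonZero : NonZero (m ℕ.+ n)
    m+n-nonZero = +-nonZeroˡ m n

  ratio-scaled : (m ℕ.+ n) · (fromℚ (ratio m n) * average I) ≐ (2 ℕ.* m ℕ.* n) · average I
  ratio-scaled = ·-fromℚ* (m ℕ.+ n) (2 ℕ.* m ℕ.* n) {ratio m n} (average I) (ratio≡ m n)

  f-optimal : ∀ s′ → 2-exchange s s′ → f s ≤ f s′
  f-optimal s′ exchange = ≤-trans (≤-reflexive (≐-sym (objective-≐ s)))
    -- Local optimality is a negated strict inequality; only after this conversion can it be added
    -- up over swaps.
    (≤-trans (≮⇒≥ (optimal s′ exchange)) (≤-reflexive (objective-≐ s′)))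

  bound : L · (m ℕ.+ n) · f s ≤ (2 ℕ.* m ℕ.* n) · ∑ₗ f feasibleSolutions
  bound = optimal⇒≤∑ₗ Q
    (λ i j → ≈⇒≤ (C≈0 i j)) (λ i j → ≈⇒≤ (≈-sym (C≈0 i j)))
    (λ k l → ≈⇒≤ (D≈0 k l)) (λ k l → ≈⇒≤ (≈-sym (D≈0 k l)))
    0≤Q s feasible f-optimal

  f≤ratio*average : f s ≤ fromℚ (ratio m n) * average I
  f≤ratio*average = scaled-≤-mean L {m ℕ.+ n} {2 ℕ.* m ℕ.* n} {f s} {average I} {fromℚ (ratio m n) * average I}
    {∑ₗ f feasibleSolutions} {{L-nonZero}} bound average-scaled ratio-scaled
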